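{- Let $p>5$ be a prime. Then, in $\mathbb{Z}_p$ modulo $p^4$, \begin{align*} H_{p-1,p-3}&\equiv\frac{37p^3}{12}-3p^2+\frac{3p}{4}-p^2(pB_{p-1})+3p(p-3)\mathcal{B}_{p+1}-\frac{1}{2}\Big(p-3+\frac{11p^3}{2}\Big)B_{2p}\pmod{p^4},\\ H_{p-1,p-1}&\equiv\frac{13p^3+12p-12}{3}+\frac{19p^3-12}{2}\,pB_{p-1}+(4-7p^3)\,pB_{2(p-1)}+\frac{11p^3-6}{6}\,pB_{3(p-1)}\pmod{p^4}. \end{align*}
   Context: $B_n$ denotes the $n$-th Bernoulli number and $\mathcal{B}_n:=B_n/n$ for $n\ge1$. For an integer $k\ge1$, $H_{p-1,k}:=\sum_{a=1}^{p-1}a^{ -k}$ is the generalized harmonic number. Congruences are in $\mathbb{Q}_p$: $x\equiv y\pmod{p^4}$ means $x-y\in p^4\mathbb{Z}_p$. -}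

module Defs where

open import Data.Nat as ℕ using (ℕ; zero; suc)
open import Data.Nat.Divisibility using (_∣_)
open import Data.Nat.Combinatorics using (_C_)
open import Data.Integer as ℤ using (ℤ; +_)
open import Data.Rational as ℚ using (ℚ; _+_; _*_; _-_; -_; 0ℚ; 1ℚ; ↥_; ↧ₙ_)
open import Data.List using (List; []; _∷_; _++_)
open import Data.Product using (_×_)
open import Relation.Nullary using (¬_)

q : ℕ → ℚ
q n = (+ n) ℚ./ 1

nth : List ℚ → ℕ → ℚ
nth []       _       = 0ℚ
nth (x ∷ _)  zero    = x
nth (_ ∷ xs) (suc k) = nth xs k

binSum : ℕ → ℕ → List ℚ → ℚ
binSum m k []       = 0ℚ
binSum m k (b ∷ bs) = q (suc m C k) * b + binSum m (suc k) bs

-- [B_0, …, B_n] using  B_0 = 1,  Σ_{k=0}^{m} C(m+1,k) B_k = 0  (m ≥ 1), so B_1 = -1/2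
bernList : ℕ → List ℚ
bernList zero    = 1ℚ ∷ []
bernList (suc n) = bs ++ (next ∷ [])
  where
    bs : List ℚ
    bs = bernList n
    next : ℚ
    next = - ((+ 1 ℚ./ suc (suc n)) * binSum (suc n) 0 bs)

B : ℕ → ℚ
B n = nth (bernList n) n

calB : (n : ℕ) → .{{_ : ℕ.NonZero n}} → ℚ
calB n = B n * (+ 1 ℚ./ n)

invPow : ℕ → ℕ → ℚ
invPow a' zero    = 1ℚ
invPow a' (suc k) = invPow a' k * (+ 1 ℚ./ suc a')

H : ℕ → ℕ → ℚ
H zero    k = 0ℚ
H (suc n) k = H n k + invPow n k

-- x ≡ y (mod p^e) in ℚ_p: x - y ∈ p^e ℤ_p, i.e. (reduced) numerator divisible
-- by p^e and denominator prime to p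
CongP : ℕ → ℕ → ℚ → ℚ → Set
CongP p e x y = (p ℕ.^ e ∣ ℤ.∣ ↥ (x - y) ∣) × ¬ (p ∣ ↧ₙ (x - y))

{-# OPTIONS --safe #-}

-- Write xₐ = a^(p−1) ≡ 1 (mod p).  From 1/x = 4 − 6x + 4x² − x³ + (x − 1)⁴/x, the sums H_{p−1,p−1} and
-- H_{p−1,p−3} are, modulo p⁴, combinations of the power sums Σ aᵐ with m = j(p−1) and m = 2 + j(p−1), j ≤ 3.
-- Faulhaber's formula gives Σ aᵐ ≡ pB_m + m(m−1)/6 · p² · pB_{m−2} (mod p⁴) for even m ≥ 6.  For H_{p−1,p−1}
-- the second order terms cancel and pB_{j(p−1)} ≡ −1 (mod p) accounts for the remaining p³-terms.  For
-- H_{p−1,p−3} one also needs Kummer's congruence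
--   B_{3p−1}/(3p−1) − 3 B_{2p}/(2p) + 3 B_{p+1}/(p+1) ≡ (1 − p)/12 (mod p³).
-- It is read off from the alternating sums Σ (−1)ᵃ aⁿ, whose generating function is (e^{pt} + 1)/(eᵗ + 1):
-- the coefficients of 1/(eᵗ + 1) are (1 − 2^{n+1}) B_{n+1}/(n+1), and they are p-integral.
module Submission where

open import Algebra using (Op₁; Op₂; CommutativeRing; CommutativeSemiring)
open import Algebra.Structures using (IsCommutativeRing)
import Algebra.Solver.Ring as RingSolver
import Algebra.Solver.Ring.NaturalCoefficients.Default as NatCoeffSolver
open import Algebra.Solver.Ring.AlmostCommutativeRing using (fromCommutativeRing; _-Raw-AlmostCommutative⟶_)
open import Data.Integer as ℤ using (ℤ) renaming (+_ to pos)
import Data.Integer.Properties as ℤP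
open import Data.Maybe.Base using (map)
open import Data.Nat as ℕ using (ℕ; zero; suc; _<_; _≤_; _∸_; z≤n; s≤s)
open import Data.Nat.Combinatorics using (_C_; nCk+nC[k+1]≡[n+1]C[k+1]; nCn≡1; k>n⇒nCk≡0; nC1≡n; nCk≡nC[n∸k])
open import Data.Nat.Divisibility using (_∣_; divides; _∣?_; >⇒∤; ∣m⇒∣m*n; 1∣_; *-cancelʳ-∣; *-monoʳ-∣; ∣-refl)
open import Data.Nat.Primality using (Prime; euclidsLemma; prime⇒nonTrivial; prime⇒nonZero; prime⇒irreducible; ¬prime[1])
import Data.Nat.Properties as ℕP
open import Data.Nat.Solver using (module +-*-Solver)
open import Data.Product using (_×_; _,_; ∃-syntax)
open import Data.Sum using (_⊎_; inj₁; inj₂; [_,_]′)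
import Relation.Binary.Reasoning.Setoid as SetoidReasoning
open import Relation.Binary.Consequences using (dec⇒weaklyDec)
open import Relation.Binary.PropositionalEquality
open import Relation.Nullary using (¬_; yes; no; contradiction)
open import Relation.Nullary.Decidable using (recompute)

-- Why alternating sums: Faulhaber's formula yields pB_m instead of B_m, so a third difference of
-- ordinary power sums, which is divisible by p³, controls the Bernoulli numbers only modulo p². In
-- H_{p-1,p-3} the Kummer combination is multiplied by just one p, hence it is needed modulo p³. The
-- coefficients of 1/(eᵗ + 1) are integral themselves and lose no factor p. The price is the factor
-- 1 - 2^{n+1}: for n + 1 ≡ 2 (mod p - 1) it is ≡ -3 (mod p), hence a unit, but it varies with n and
-- has to be stripped off with the help of the differences of lower order. The constant (1 - p)/12
-- is the missing member of the third difference, (1 - p)B_2/2; it comes from the exact value (p -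
-- 1)/2 of Σ (-1)ᵃ a. The p-integrality of pB_n is not imported from von Staudt-Clausen: Faulhaber's
-- formula expresses pB_n by a power sum and by earlier Bernoulli numbers, and strong induction does
-- the rest.

C-absorb : ∀ n k → suc k ℕ.* (suc n C suc k) ≡ suc n ℕ.* (n C k)
C-absorb zero    zero    = refl
C-absorb zero    (suc k) = trans (cong (suc (suc k) ℕ.*_) (k>n⇒nCk≡0 {1} {suc (suc k)} (s≤s (s≤s z≤n))))
  (trans (ℕP.*-zeroʳ (suc (suc k))) (sym (cong (1 ℕ.*_) (k>n⇒nCk≡0 {0} {suc k} (s≤s z≤n)))))
C-absorb (suc n) zero    = trans (cong (1 ℕ.*_) (nC1≡n (suc (suc n)))) (ℕP.*-comm 1 (suc (suc n)))
C-absorb (suc n) (suc k) = begin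
  suc (suc k) ℕ.* (suc (suc n) C suc (suc k))
    ≡⟨ cong (suc (suc k) ℕ.*_) (nCk+nC[k+1]≡[n+1]C[k+1] (suc n) (suc k)) ⟨
  suc (suc k) ℕ.* (c ℕ.+ (suc n C suc (suc k)))
    ≡⟨ ℕP.*-distribˡ-+ (suc (suc k)) c _ ⟩
  c ℕ.+ suc k ℕ.* c ℕ.+ suc (suc k) ℕ.* (suc n C suc (suc k))
    ≡⟨ cong₂ (λ x y → c ℕ.+ x ℕ.+ y) (C-absorb n k) (C-absorb n (suc k)) ⟩
  c ℕ.+ suc n ℕ.* (n C k) ℕ.+ suc n ℕ.* (n C suc k)
    ≡⟨ ℕP.+-assoc c _ _ ⟩
  c ℕ.+ (suc n ℕ.* (n C k) ℕ.+ suc n ℕ.* (n C suc k))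
    ≡⟨ cong (c ℕ.+_) (ℕP.*-distribˡ-+ (suc n) (n C k) (n C suc k)) ⟨
  c ℕ.+ suc n ℕ.* (n C k ℕ.+ n C suc k)
    ≡⟨ cong (λ z → c ℕ.+ suc n ℕ.* z) (nCk+nC[k+1]≡[n+1]C[k+1] n k) ⟩
  suc (suc n) ℕ.* c ∎
  where
  open ≡-Reasoning
  c = suc n C suc k

-- Raising j by one adds 1 on the left and at least doubles the right. The bound forces v_p(e + j +
-- 1) ≤ j, which controls the denominators in Faulhaber's formula.
p^-growth : ∀ {p} e j → suc e < p → suc (e ℕ.+ j) < p ℕ.^ suc j
p^-growth {p} e zero    e<p = subst₂ (λ x y → suc x < y) (sym (ℕP.+-identityʳ e)) (sym (ℕP.*-identityʳ p)) e<p
p^-growth {p} e (suc j) e<p = begin-strict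
  suc (e ℕ.+ suc j)        ≡⟨ cong suc (ℕP.+-suc e j) ⟩
  suc (suc (e ℕ.+ j))      ≤⟨ p^-growth e j e<p ⟩
  q                        <⟨ ℕP.m<m+n q (ℕP.≤-<-trans z≤n (p^-growth e j e<p)) ⟩
  q ℕ.+ q                  ≡⟨ cong (q ℕ.+_) (ℕP.+-identityʳ q) ⟨
  2 ℕ.* q                  ≤⟨ ℕP.*-monoˡ-≤ q (ℕP.≤-trans (s≤s (s≤s z≤n)) e<p) ⟩
  p ℕ.* q                  ∎
  where
  open ℕP.≤-Reasoning
  q = p ℕ.^ suc j

-- The argument only uses that ℚ is a commutative ring in which the positive integers are invertible.
record RationalAlgebra : Set₁ where
  infix  8 -_
  infixl 7 _*_
  infixl 6 _+_
  field
    Carrier           : Set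
    _+_ _*_           : Op₂ Carrier
    -_                : Op₁ Carrier
    ι                 : ℤ → Carrier
    isCommutativeRing : IsCommutativeRing _≡_ _+_ _*_ -_ (ι (pos 0)) (ι (pos 1))
    ι-+               : ∀ i j → ι (i ℤ.+ j) ≡ ι i + ι j
    ι-*               : ∀ i j → ι (i ℤ.* j) ≡ ι i * ι j
    ι-neg             : ∀ i → ι (ℤ.- i) ≡ - ι i
    inv               : ℕ → Carrier
    inv-inverse       : ∀ n → ι (pos (suc n)) * inv n ≡ ι (pos 1)

  0# 1# : Carrier
  0# = ι (pos 0)
  1# = ι (pos 1)

-- Finite sums and exponential generating functions over a ℚ-algebra

module Sequences (A : RationalAlgebra) where

  open RationalAlgebra A renaming (Carrier to K)

  ring : CommutativeRing _ _
  ring = record { isCommutativeRing = isCommutativeRing }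

  open CommutativeRing ring public
    using (_-_; +-identityˡ; +-identityʳ; *-identityˡ; *-identityʳ; zeroˡ; zeroʳ;
           *-comm; *-assoc; +-comm; +-assoc; distribˡ; distribʳ; -‿inverseʳ; semiring)

  open import Algebra.Properties.Semiring.Exp semiring public using (_^_; ^-homo-*; ^-assocʳ)

  ℤ⟶K : ℤ.+-*-rawRing -Raw-AlmostCommutative⟶ fromCommutativeRing ring
  ℤ⟶K = record
    { ⟦_⟧ = ι ; +-homo = ι-+ ; *-homo = ι-* ; -‿homo = ι-neg ; 0-homo = refl ; 1-homo = refl }

  open RingSolver ℤ.+-*-rawRing (fromCommutativeRing ring) ℤ⟶K
    (λ i j → map (cong ι) (dec⇒weaklyDec ℤ._≟_ i j)) public
    using (Polynomial; solve; _:=_; _:+_; _:*_; _:-_; :-_; con)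

  κ : ∀ {m} → ℕ → Polynomial m
  κ n = con (pos n)

  ν : ℕ → K
  ν n = ι (pos n)

  ν-+ : ∀ m n → ν (m ℕ.+ n) ≡ ν m + ν n
  ν-+ m n = ι-+ (pos m) (pos n)

  ν-* : ∀ m n → ν (m ℕ.* n) ≡ ν m * ν n
  ν-* m n = trans (cong ι (ℤP.pos-* m n)) (ι-* (pos m) (pos n))

  ν-suc : ∀ n → ν (suc n) ≡ 1# + ν n
  ν-suc n = ν-+ 1 n

  ν-^ : ∀ m n → ν (m ℕ.^ n) ≡ ν m ^ n
  ν-^ m zero    = refl
  ν-^ m (suc n) = trans (ν-* m (m ℕ.^ n)) (cong (ν m *_) (ν-^ m n))

  1^ : ∀ n → 1# ^ n ≡ 1#
  1^ zero    = refl
  1^ (suc n) = trans (*-identityˡ _) (1^ n)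

  *-^ : ∀ x y n → (x * y) ^ n ≡ x ^ n * y ^ n
  *-^ x y zero    = sym (*-identityˡ _)
  *-^ x y (suc n) = trans (cong (x * y *_) (*-^ x y n))
    (solve 4 (λ x y a b → x :* y :* (a :* b) := x :* a :* (y :* b)) refl x y (x ^ n) (y ^ n))

  cancel-suc : ∀ n {x y} → ν (suc n) * x ≡ ν (suc n) * y → x ≡ y
  cancel-suc n {x} {y} eq = begin
    x                          ≡⟨ *-identityˡ x ⟨
    1# * x                     ≡⟨ cong (_* x) (inv-inverse n) ⟨
    ν (suc n) * inv n * x      ≡⟨ solve 3 (λ a b c → a :* b :* c := b :* (a :* c)) refl (ν (suc n)) (inv n) x ⟩
    inv n * (ν (suc n) * x)    ≡⟨ cong (inv n *_) eq ⟩
    inv n * (ν (suc n) * y)    ≡⟨ solve 3 (λ a b c → a :* b :* c := b :* (a :* c)) refl (ν (suc n)) (inv n) y ⟨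
    ν (suc n) * inv n * y      ≡⟨ cong (_* y) (inv-inverse n) ⟩
    1# * y                     ≡⟨ *-identityˡ y ⟩
    y                          ∎
    where open ≡-Reasoning

  +-cancelˡ : ∀ x {y z} → x + y ≡ x + z → y ≡ z
  +-cancelˡ x {y} {z} eq = begin
    y              ≡⟨ solve 2 (λ x y → y := :- x :+ (x :+ y)) refl x y ⟩
    - x + (x + y)  ≡⟨ cong (- x +_) eq ⟩
    - x + (x + z)  ≡⟨ solve 2 (λ x y → y := :- x :+ (x :+ y)) refl x z ⟨
    z              ∎
    where open ≡-Reasoning

  ∑ : ℕ → (ℕ → K) → K
  ∑ zero    f = 0#
  ∑ (suc n) f = ∑ n f + f n

  ∑-cong : ∀ n {f g : ℕ → K} → (∀ k → k < n → f k ≡ g k) → ∑ n f ≡ ∑ n g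
  ∑-cong zero    eq = refl
  ∑-cong (suc n) eq = cong₂ _+_ (∑-cong n λ k k<n → eq k (ℕP.m<n⇒m<1+n k<n)) (eq n ℕP.≤-refl)

  ∑-+ : ∀ n f g → ∑ n (λ k → f k + g k) ≡ ∑ n f + ∑ n g
  ∑-+ zero    f g = sym (+-identityˡ 0#)
  ∑-+ (suc n) f g = trans (cong (_+ (f n + g n)) (∑-+ n f g))
    (solve 4 (λ a b c d → a :+ b :+ (c :+ d) := a :+ c :+ (b :+ d)) refl (∑ n f) (∑ n g) (f n) (g n))

  ∑-* : ∀ n c f → ∑ n (λ k → c * f k) ≡ c * ∑ n f
  ∑-* zero    c f = sym (zeroʳ c)
  ∑-* (suc n) c f = trans (cong (_+ c * f n) (∑-* n c f)) (sym (distribˡ c _ _))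

  ∑-const : ∀ n c → ∑ n (λ _ → c) ≡ ν n * c
  ∑-const zero    c = sym (zeroˡ c)
  ∑-const (suc n) c = trans (cong (_+ c) (∑-const n c)) (sym (trans (cong (_* c) (ν-suc n))
    (solve 2 (λ c n → (κ 1 :+ n) :* c := n :* c :+ c) refl c (ν n) )))

  ∑-front : ∀ n f → ∑ (suc n) f ≡ f 0 + ∑ n (λ k → f (suc k))
  ∑-front zero    f = +-comm 0# (f 0)
  ∑-front (suc n) f = trans (cong (_+ f (suc n)) (∑-front n f)) (+-assoc _ _ _)

  -- Exponential generating functions: f stands for Σ f(n) tⁿ/n!, so that the shift D is
  -- the derivative and the product _⋆_ is determined by the Leibniz rule.

  Seq : Set
  Seq = ℕ → K

  D : Seq → Seq
  D f n = f (suc n)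

  infixl 7 _⋆_
  infixl 6 _⊕_

  _⊕_ : Seq → Seq → Seq
  (f ⊕ g) n = f n + g n

  _⋆_ : Seq → Seq → Seq
  (f ⋆ g) zero    = f 0 * g 0
  (f ⋆ g) (suc n) = (D f ⋆ g) n + (f ⋆ D g) n

  𝟘 𝟙 X : Seq
  𝟘 _       = 0#
  𝟙 zero    = 1#
  𝟙 (suc _) = 0#
  X zero    = 0#
  X (suc n) = 𝟙 n

  ⋆-cong : ∀ {f f′ g g′} → f ≗ f′ → g ≗ g′ → f ⋆ g ≗ f′ ⋆ g′
  ⋆-cong p q zero    = cong₂ _*_ (p 0) (q 0)
  ⋆-cong p q (suc n) = cong₂ _+_ (⋆-cong (λ k → p (suc k)) q n) (⋆-cong p (λ k → q (suc k)) n)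

  ⋆-comm : ∀ f g → f ⋆ g ≗ g ⋆ f
  ⋆-comm f g zero    = *-comm (f 0) (g 0)
  ⋆-comm f g (suc n) = trans (cong₂ _+_ (⋆-comm (D f) g n) (⋆-comm f (D g) n)) (+-comm _ _)

  ⋆-distribˡ : ∀ f g h → f ⋆ (g ⊕ h) ≗ f ⋆ g ⊕ f ⋆ h
  ⋆-distribˡ f g h zero    = distribˡ (f 0) (g 0) (h 0)
  ⋆-distribˡ f g h (suc n) = trans (cong₂ _+_ (⋆-distribˡ (D f) g h n) (⋆-distribˡ f (D g) (D h) n))
    (solve 4 (λ a b c d → a :+ b :+ (c :+ d) := a :+ c :+ (b :+ d)) refl
      ((D f ⋆ g) n) ((D f ⋆ h) n) ((f ⋆ D g) n) ((f ⋆ D h) n))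

  ⋆-distribʳ : ∀ f g h → (g ⊕ h) ⋆ f ≗ g ⋆ f ⊕ h ⋆ f
  ⋆-distribʳ f g h n = trans (⋆-comm (g ⊕ h) f n)
    (trans (⋆-distribˡ f g h n) (cong₂ _+_ (⋆-comm f g n) (⋆-comm f h n)))

  ⋆-assoc : ∀ f g h → (f ⋆ g) ⋆ h ≗ f ⋆ (g ⋆ h)
  ⋆-assoc f g h zero    = *-assoc (f 0) (g 0) (h 0)
  ⋆-assoc f g h (suc n) = begin
    (((D f ⋆ g) ⊕ (f ⋆ D g)) ⋆ h) n + ((f ⋆ g) ⋆ D h) n
      ≡⟨ cong₂ _+_ (⋆-distribʳ h (D f ⋆ g) (f ⋆ D g) n) (⋆-assoc f g (D h) n) ⟩
    ((D f ⋆ g) ⋆ h) n + ((f ⋆ D g) ⋆ h) n + (f ⋆ (g ⋆ D h)) n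
      ≡⟨ cong (_+ (f ⋆ (g ⋆ D h)) n) (cong₂ _+_ (⋆-assoc (D f) g h n) (⋆-assoc f (D g) h n)) ⟩
    (D f ⋆ (g ⋆ h)) n + (f ⋆ (D g ⋆ h)) n + (f ⋆ (g ⋆ D h)) n
      ≡⟨ +-assoc _ _ _ ⟩
    (D f ⋆ (g ⋆ h)) n + ((f ⋆ (D g ⋆ h)) n + (f ⋆ (g ⋆ D h)) n)
      ≡⟨ cong ((D f ⋆ (g ⋆ h)) n +_) (⋆-distribˡ f (D g ⋆ h) (g ⋆ D h) n) ⟨
    (D f ⋆ (g ⋆ h)) n + (f ⋆ (D g ⋆ h ⊕ g ⋆ D h)) n ∎
    where open ≡-Reasoning

  ⋆-zeroˡ : ∀ f → 𝟘 ⋆ f ≗ 𝟘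
  ⋆-zeroˡ f zero    = zeroˡ (f 0)
  ⋆-zeroˡ f (suc n) = trans (cong₂ _+_ (⋆-zeroˡ f n) (⋆-zeroˡ (D f) n)) (+-identityˡ 0#)

  ⋆-identityˡ : ∀ f → 𝟙 ⋆ f ≗ f
  ⋆-identityˡ f zero    = *-identityˡ (f 0)
  ⋆-identityˡ f (suc n) = trans (cong₂ _+_ (⋆-zeroˡ f n) (⋆-identityˡ (D f) n)) (+-identityˡ _)

  Seq-semiring : CommutativeSemiring _ _
  Seq-semiring = record
    { Carrier = Seq ; _≈_ = _≗_ ; _+_ = _⊕_ ; _*_ = _⋆_ ; 0# = 𝟘 ; 1# = 𝟙
    ; isCommutativeSemiring = record
      { isSemiring = record
        { isSemiringWithoutAnnihilatingZero = record
          { +-isCommutativeMonoid = record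
            { isMonoid = record
              { isSemigroup = record
                { isMagma = record
                  { isEquivalence = record
                    { refl = λ _ → refl ; sym = λ p n → sym (p n) ; trans = λ p q n → trans (p n) (q n) }
                  ; ∙-cong = λ p q n → cong₂ _+_ (p n) (q n) }
                ; assoc = λ f g h n → +-assoc (f n) (g n) (h n) }
              ; identity = (λ f n → +-identityˡ (f n)) , λ f n → +-identityʳ (f n) }
            ; comm = λ f g n → +-comm (f n) (g n) }
          ; *-cong = ⋆-cong
          ; *-assoc = ⋆-assoc
          ; *-identity = ⋆-identityˡ , λ f n → trans (⋆-comm f 𝟙 n) (⋆-identityˡ f n)
          ; distrib = ⋆-distribˡ , ⋆-distribʳ }
        ; zero = ⋆-zeroˡ , λ f n → trans (⋆-comm f 𝟘 n) (⋆-zeroˡ f n) }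
      ; *-comm = ⋆-comm } }

  module Seq-Solver = NatCoeffSolver Seq-semiring
  module Seq = CommutativeSemiring Seq-semiring
  module Seq-Reasoning = SetoidReasoning Seq.setoid

  X⋆ : ∀ f n → (X ⋆ f) (suc n) ≡ ν (suc n) * f n
  X⋆ f zero = begin
    1# * f 0 + 0# * f 1
      ≡⟨ cong (1# * f 0 +_) (zeroˡ (f 1)) ⟩
    ν 1 * f 0 + 0#
      ≡⟨ +-identityʳ _ ⟩
    ν 1 * f 0 ∎
    where open ≡-Reasoning
  X⋆ f (suc n) = begin
    (𝟙 ⋆ f) (suc n) + (X ⋆ D f) (suc n)
      ≡⟨ cong₂ _+_ (⋆-identityˡ f (suc n)) (X⋆ (D f) n) ⟩
    f (suc n) + ν (suc n) * f (suc n)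
      ≡⟨ cong (_+ ν (suc n) * f (suc n)) (*-identityˡ _) ⟨
    1# * f (suc n) + ν (suc n) * f (suc n)
      ≡⟨ distribʳ (f (suc n)) 1# (ν (suc n)) ⟨
    (1# + ν (suc n)) * f (suc n)
      ≡⟨ cong (_* f (suc n)) (ν-suc (suc n)) ⟨
    ν (suc (suc n)) * f (suc n) ∎
    where open ≡-Reasoning

  -- Cancelling t is possible because the coefficients of t·f are those of f times positive
  -- integers. Identities involving 1/t or 1/(eᵗ - 1) are therefore proved after multiplication by
  -- t.
  X-cancel : ∀ {f g} → X ⋆ f ≗ X ⋆ g → f ≗ g
  X-cancel {f} {g} eq n = cancel-suc n (trans (sym (X⋆ f n)) (trans (eq (suc n)) (X⋆ g n)))

  ⋆-formula : ∀ f g n → (f ⋆ g) n ≡ ∑ (suc n) (λ k → ν (n C k) * (f k * g (n ∸ k)))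
  ⋆-formula f g zero    = trans (sym (*-identityˡ _)) (sym (+-identityˡ _))
  ⋆-formula f g (suc n) = begin
    (D f ⋆ g) n + (f ⋆ D g) n
      ≡⟨ cong₂ _+_ (⋆-formula (D f) g n) (⋆-formula f (D g) n) ⟩
    u + ∑ (suc n) (λ k → ν (n C k) * (f k * g (suc (n ∸ k))))
      ≡⟨ cong (u +_) (∑-front n _) ⟩
    u + (ν 1 * (f 0 * g (suc n)) + ∑ n (λ k → ν (n C suc k) * (f (suc k) * g (suc (n ∸ suc k)))))
      ≡⟨ cong (λ z → u + (ν 1 * (f 0 * g (suc n)) + z)) (∑-cong n λ k k<n →
           cong (λ z → ν (n C suc k) * (f (suc k) * g z)) (sym (ℕP.+-∸-assoc 1 k<n))) ⟩
    u + (ν 1 * (f 0 * g (suc n)) + w)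
      ≡⟨ solve 3 (λ u z w → u :+ (z :+ w) := z :+ (u :+ (w :+ κ 0))) refl u (ν 1 * (f 0 * g (suc n))) w ⟩
    ν 1 * (f 0 * g (suc n)) + (u + (w + ν 0))
      -- The second sum is padded by its vanishing term with C(n, n+1) = 0, so that both sums have
      -- the same range and Pascal's rule applies termwise.
      ≡⟨ cong (λ z → ν 1 * (f 0 * g (suc n)) + (u + (w + z))) top ⟩
    ν 1 * (f 0 * g (suc n)) + (u + (w + ν (n C suc n) * (f (suc n) * g (n ∸ n))))
      ≡⟨ cong (ν 1 * (f 0 * g (suc n)) +_) (∑-+ (suc n) _ _) ⟨
    ν 1 * (f 0 * g (suc n)) + ∑ (suc n) (λ k → ν (n C k) * (f (suc k) * g (n ∸ k)) + ν (n C suc k) * (f (suc k) * g (n ∸ k)))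
      ≡⟨ cong (ν 1 * (f 0 * g (suc n)) +_) (∑-cong (suc n) λ k _ →
           trans (sym (distribʳ _ _ _)) (cong (_* (f (suc k) * g (n ∸ k)))
             (trans (sym (ν-+ _ _)) (cong ν (nCk+nC[k+1]≡[n+1]C[k+1] n k))))) ⟩
    ν 1 * (f 0 * g (suc n)) + ∑ (suc n) (λ k → ν (suc n C suc k) * (f (suc k) * g (n ∸ k)))
      ≡⟨ ∑-front (suc n) _ ⟨
    ∑ (suc (suc n)) (λ k → ν (suc n C k) * (f k * g (suc n ∸ k))) ∎
    where
    open ≡-Reasoning
    u w : K
    u = ∑ (suc n) (λ k → ν (n C k) * (f (suc k) * g (n ∸ k)))
    w = ∑ n (λ k → ν (n C suc k) * (f (suc k) * g (n ∸ k)))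
    top : ν 0 ≡ ν (n C suc n) * (f (suc n) * g (n ∸ n))
    top = sym (trans (cong (λ z → ν z * (f (suc n) * g (n ∸ n))) (k>n⇒nCk≡0 {n} {suc n} ℕP.≤-refl))
                     (zeroˡ _))

  ⋆-scaleˡ : ∀ c f g n → ((λ k → c * f k) ⋆ g) n ≡ c * (f ⋆ g) n
  ⋆-scaleˡ c f g zero    = *-assoc c (f 0) (g 0)
  ⋆-scaleˡ c f g (suc n) = trans (cong₂ _+_ (⋆-scaleˡ c (D f) g n) (⋆-scaleˡ c f (D g) n)) (sym (distribˡ c _ _))

  ⋆-scaleʳ : ∀ c f g n → (f ⋆ (λ k → c * g k)) n ≡ c * (f ⋆ g) n
  ⋆-scaleʳ c f g n = trans (⋆-comm f _ n) (trans (⋆-scaleˡ c g f n) (cong (c *_) (⋆-comm g f n)))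

  exp : K → Seq
  exp c n = c ^ n

  exp-⋆ : ∀ c d → exp c ⋆ exp d ≗ exp (c + d)
  exp-⋆ c d zero    = *-identityˡ 1#
  exp-⋆ c d (suc n) = begin
    ((λ k → c * c ^ k) ⋆ exp d) n + (exp c ⋆ (λ k → d * d ^ k)) n
      ≡⟨ cong₂ _+_ (⋆-scaleˡ c (exp c) (exp d) n) (⋆-scaleʳ d (exp c) (exp d) n) ⟩
    c * (exp c ⋆ exp d) n + d * (exp c ⋆ exp d) n
      ≡⟨ distribʳ _ c d ⟨
    (c + d) * (exp c ⋆ exp d) n
      ≡⟨ cong ((c + d) *_) (exp-⋆ c d n) ⟩
    (c + d) * (c + d) ^ n ∎
    where open ≡-Reasoning

  exp-0 : exp 0# ≗ 𝟙
  exp-0 zero    = refl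
  exp-0 (suc n) = zeroˡ _

  -- The substitution of ct for t in the generating function.
  dilate : K → Seq → Seq
  dilate c f n = c ^ n * f n

  dilate-D : ∀ c f n → D (dilate c f) n ≡ c * dilate c (D f) n
  dilate-D c f n = *-assoc c (c ^ n) (f (suc n))

  dilate-⋆ : ∀ c f g → dilate c (f ⋆ g) ≗ dilate c f ⋆ dilate c g
  dilate-⋆ c f g zero    = solve 2 (λ f g → κ 1 :* (f :* g) := κ 1 :* f :* (κ 1 :* g)) refl (f 0) (g 0)
  dilate-⋆ c f g (suc n) = begin
    c * c ^ n * ((D f ⋆ g) n + (f ⋆ D g) n)
      ≡⟨ solve 4 (λ c d a b → c :* d :* (a :+ b) := c :* (d :* a) :+ c :* (d :* b)) refl c (c ^ n) ((D f ⋆ g) n) ((f ⋆ D g) n) ⟩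
    c * dilate c (D f ⋆ g) n + c * dilate c (f ⋆ D g) n
      ≡⟨ cong₂ (λ x y → c * x + c * y) (dilate-⋆ c (D f) g n) (dilate-⋆ c f (D g) n) ⟩
    c * (dilate c (D f) ⋆ dilate c g) n + c * (dilate c f ⋆ dilate c (D g)) n
      ≡⟨ cong₂ _+_ (⋆-scaleˡ c _ _ n) (⋆-scaleʳ c _ _ n) ⟨
    ((λ k → c * dilate c (D f) k) ⋆ dilate c g) n + (dilate c f ⋆ (λ k → c * dilate c (D g) k)) n
      ≡⟨ cong₂ _+_ (⋆-cong (dilate-D c f) (λ _ → refl) n) (⋆-cong {dilate c f} (λ _ → refl) (dilate-D c g) n) ⟨
    (D (dilate c f) ⋆ dilate c g) n + (dilate c f ⋆ D (dilate c g)) n ∎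
    where open ≡-Reasoning

  dilate-exp-1 : ∀ c → dilate c (exp 1#) ≗ exp c
  dilate-exp-1 c n = trans (cong (c ^ n *_) (1^ n)) (trans (*-comm _ 1#) (*-identityˡ _))

  dilate-X : ∀ c n → dilate c X n ≡ c * X n
  dilate-X c zero          = trans (zeroʳ _) (sym (zeroʳ c))
  dilate-X c (suc zero)    = solve 1 (λ c → c :* κ 1 :* κ 1 := c :* κ 1) refl c
  dilate-X c (suc (suc n)) = trans (zeroʳ _) (sym (zeroʳ c))

  ⊕-cancelˡ : ∀ f {g h} → f ⊕ g ≗ f ⊕ h → g ≗ h
  ⊕-cancelˡ f eq n = +-cancelˡ (f n) (eq n)

  -- Generating functions of power sums

  powerSum : ℕ → Seq
  powerSum N n = ∑ N (λ a → ν a ^ n)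

  altPowerSum : ℕ → Seq
  altPowerSum N n = ∑ N (λ a → (- 1#) ^ a * ν a ^ n)

  -- Multiplication of Σ e^{at} by eᵗ shifts the range of a by one, so only the end terms 1 and
  -- e^{Nt} differ.
  powerSum-E : ∀ N → powerSum N ⋆ exp 1# ⊕ 𝟙 ≗ powerSum N ⊕ exp (ν N)
  powerSum-E zero    n = cong₂ _+_ (⋆-zeroˡ (exp 1#) n) (sym (exp-0 n))
  powerSum-E (suc N) n = begin
    ((S ⊕ exp (ν N)) ⋆ exp 1#) n + 𝟙 n
      ≡⟨ cong (_+ 𝟙 n) (⋆-distribʳ (exp 1#) S (exp (ν N)) n) ⟩
    (S ⋆ exp 1#) n + (exp (ν N) ⋆ exp 1#) n + 𝟙 n
      ≡⟨ solve 3 (λ a b c → a :+ b :+ c := a :+ c :+ b) refl ((S ⋆ exp 1#) n) _ (𝟙 n) ⟩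
    (S ⋆ exp 1#) n + 𝟙 n + (exp (ν N) ⋆ exp 1#) n
      ≡⟨ cong₂ _+_ (powerSum-E N n) (exp-⋆ (ν N) 1# n) ⟩
    S n + ν N ^ n + (ν N + 1#) ^ n
      ≡⟨ cong (λ z → S n + ν N ^ n + z ^ n) (trans (+-comm (ν N) 1#) (sym (ν-suc N))) ⟩
    S n + ν N ^ n + ν (suc N) ^ n ∎
    where
    open ≡-Reasoning
    S = powerSum N

  -- With signs, multiplication by eᵗ + 1 makes neighbouring terms cancel. The sign of the end term
  -- is left open here; the parity of N is fixed only in `altPowerSum-e`.
  altPowerSum-E : ∀ N n → (altPowerSum N ⋆ (exp 1# ⊕ 𝟙)) n + (- 1#) ^ N * ν N ^ n ≡ 𝟙 n
  altPowerSum-E zero    n = trans (cong₂ _+_ (⋆-zeroˡ (exp 1# ⊕ 𝟙) n) (trans (*-identityˡ _) (exp-0 n))) (+-identityˡ _)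
  altPowerSum-E (suc N) n = begin
    ((T ⊕ V) ⋆ (exp 1# ⊕ 𝟙)) n + - 1# * s * ν (suc N) ^ n
      ≡⟨ cong₂ _+_ (⋆-distribʳ (exp 1# ⊕ 𝟙) T V n) (cong (λ z → - 1# * s * z ^ n) (trans (ν-suc N) (+-comm 1# (ν N)))) ⟩
    (T ⋆ (exp 1# ⊕ 𝟙)) n + (V ⋆ (exp 1# ⊕ 𝟙)) n + - 1# * s * (ν N + 1#) ^ n
      ≡⟨ cong (λ z → (T ⋆ (exp 1# ⊕ 𝟙)) n + z + - 1# * s * (ν N + 1#) ^ n)
           (trans (⋆-scaleˡ s (exp (ν N)) (exp 1# ⊕ 𝟙) n) (cong (s *_) (trans (⋆-distribˡ (exp (ν N)) (exp 1#) 𝟙 n)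
             (cong₂ _+_ (exp-⋆ (ν N) 1# n) (trans (⋆-comm (exp (ν N)) 𝟙 n) (⋆-identityˡ _ n)))))) ⟩
    (T ⋆ (exp 1# ⊕ 𝟙)) n + s * ((ν N + 1#) ^ n + ν N ^ n) + - 1# * s * (ν N + 1#) ^ n
      ≡⟨ solve 4 (λ t s a b → t :+ s :* (a :+ b) :+ (:- κ 1) :* s :* a := t :+ s :* b) refl ((T ⋆ (exp 1# ⊕ 𝟙)) n) s ((ν N + 1#) ^ n) (ν N ^ n) ⟩
    (T ⋆ (exp 1# ⊕ 𝟙)) n + s * ν N ^ n
      ≡⟨ altPowerSum-E N n ⟩
    𝟙 n ∎
    where
    open ≡-Reasoning
    T V : Seq
    T = altPowerSum N
    s = (- 1#) ^ N
    V k = s * ν N ^ k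

  -- The generating function is (e^{ct} - 1)/t.
  powerQuotient : K → Seq
  powerQuotient c n = c ^ suc n * inv n

  X⋆powerQuotient : ∀ c → X ⋆ powerQuotient c ⊕ 𝟙 ≗ exp c
  X⋆powerQuotient c zero    = solve 1 (λ x → κ 0 :* x :+ κ 1 := κ 1) refl (powerQuotient c 0)
  X⋆powerQuotient c (suc n) = begin
    (X ⋆ powerQuotient c) (suc n) + 0#   ≡⟨ +-identityʳ _ ⟩
    (X ⋆ powerQuotient c) (suc n)        ≡⟨ X⋆ (powerQuotient c) n ⟩
    ν (suc n) * (c ^ suc n * inv n)      ≡⟨ solve 3 (λ m c i → m :* (c :* i) := c :* (m :* i)) refl (ν (suc n)) (c ^ suc n) (inv n) ⟩
    c ^ suc n * (ν (suc n) * inv n)      ≡⟨ cong (c ^ suc n *_) (inv-inverse n) ⟩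
    c ^ suc n * 1#                       ≡⟨ trans (*-comm _ 1#) (*-identityˡ _) ⟩
    c ^ suc n                            ∎
    where open ≡-Reasoning

  -- Bernoulli numbers through t/(eᵗ - 1) and 1/(eᵗ + 1)

  module Bernoulli (b : Seq) (b-zero : b 0 ≡ 1#)
    (b-rec : ∀ n → ∑ (suc (suc n)) (λ k → ν (suc (suc n) C k) * b k) ≡ 0#) where

    open Seq-Solver using () renaming (solve to solveˢ; _:=_ to _:=ˢ_; _:+_ to _:+ˢ_; _:*_ to _:*ˢ_)

    -- This is b(eᵗ - 1) = t. The recurrence supplies the coefficients from t² on; the term t itself
    -- comes from `b-zero`.
    b⋆E : b ⋆ exp 1# ≗ b ⊕ X
    b⋆E zero          = trans (trans (*-comm _ 1#) (*-identityˡ _)) (sym (+-identityʳ _))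
    b⋆E (suc zero)    = begin
      b 1 * 1# + b 0 * (1# * 1#)  ≡⟨ cong (λ z → b 1 * 1# + z * (1# * 1#)) b-zero ⟩
      b 1 * 1# + 1# * (1# * 1#)   ≡⟨ solve 1 (λ b → b :* κ 1 :+ κ 1 :* (κ 1 :* κ 1) := b :+ κ 1) refl (b 1) ⟩
      b 1 + 1#                    ∎
      where open ≡-Reasoning
    b⋆E (suc (suc n)) = begin
      (b ⋆ exp 1#) (suc (suc n))
        ≡⟨ ⋆-formula b (exp 1#) (suc (suc n)) ⟩
      ∑ (suc (suc (suc n))) (λ k → ν (suc (suc n) C k) * (b k * 1# ^ (suc (suc n) ∸ k)))
        ≡⟨ ∑-cong (suc (suc (suc n))) (λ k _ → cong (ν (suc (suc n) C k) *_)
             (trans (cong (b k *_) (1^ (suc (suc n) ∸ k))) (trans (*-comm _ 1#) (*-identityˡ _)))) ⟩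
      ∑ (suc (suc n)) (λ k → ν (suc (suc n) C k) * b k) + ν (suc (suc n) C suc (suc n)) * b (suc (suc n))
        ≡⟨ cong₂ (λ x y → x + ν y * b (suc (suc n))) (b-rec n) (nCn≡1 (suc (suc n))) ⟩
      0# + 1# * b (suc (suc n))
        ≡⟨ solve 1 (λ b → κ 0 :+ κ 1 :* b := b :+ κ 0) refl (b (suc (suc n))) ⟩
      b (suc (suc n)) + 0# ∎
      where open ≡-Reasoning

    -- Division by eᵗ - 1 without inverting a series: f(eᵗ - 1) = h implies tf = f·b(eᵗ - 1) = hb.
    telescoped : ∀ {f h} → f ⋆ exp 1# ≗ f ⊕ h → X ⋆ f ≗ h ⋆ b
    telescoped {f} {h} eq = ⊕-cancelˡ (f ⋆ b) (begin
      f ⋆ b ⊕ X ⋆ f      ≈⟨ solveˢ 3 (λ f b x → f :*ˢ b :+ˢ x :*ˢ f :=ˢ f :*ˢ (b :+ˢ x)) (λ _ → refl) f b X ⟩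
      f ⋆ (b ⊕ X)        ≈⟨ ⋆-cong {f} (λ _ → refl) b⋆E ⟨
      f ⋆ (b ⋆ exp 1#)   ≈⟨ solveˢ 3 (λ f b e → f :*ˢ (b :*ˢ e) :=ˢ f :*ˢ e :*ˢ b) (λ _ → refl) f b (exp 1#) ⟩
      f ⋆ exp 1# ⋆ b     ≈⟨ ⋆-cong {g = b} eq (λ _ → refl) ⟩
      (f ⊕ h) ⋆ b        ≈⟨ ⋆-distribʳ b f h ⟩
      f ⋆ b ⊕ h ⋆ b      ∎)
      where open Seq-Reasoning

    -- `telescoped` is applied with h = e^{Nt} - 1, which is t times `powerQuotient`; the common
    -- factor t then cancels.
    faulhaber : ∀ N → powerSum N ≗ powerQuotient (ν N) ⋆ b
    faulhaber N = X-cancel λ n → trans (telescoped {S} {X ⋆ F} step n) (⋆-assoc X F b n)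
      where
      S = powerSum N
      F = powerQuotient (ν N)
      step : S ⋆ exp 1# ≗ S ⊕ X ⋆ F
      step = ⊕-cancelˡ 𝟙 (begin
        𝟙 ⊕ S ⋆ exp 1#      ≈⟨ Seq.+-comm 𝟙 (S ⋆ exp 1#) ⟩
        S ⋆ exp 1# ⊕ 𝟙      ≈⟨ powerSum-E N ⟩
        S ⊕ exp (ν N)       ≈⟨ (λ n → cong (S n +_) (X⋆powerQuotient (ν N) n)) ⟨
        S ⊕ (X ⋆ F ⊕ 𝟙)     ≈⟨ solveˢ 3 (λ s f u → s :+ˢ (f :+ˢ u) :=ˢ u :+ˢ (s :+ˢ f)) (λ _ → refl) S (X ⋆ F) 𝟙 ⟩
        𝟙 ⊕ (S ⊕ X ⋆ F)     ∎)
        where open Seq-Reasoning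

    dilate-b⋆E : ∀ c n → (dilate c b ⋆ exp c) n ≡ dilate c b n + c * X n
    dilate-b⋆E c n = begin
      (dilate c b ⋆ exp c) n                  ≡⟨ ⋆-cong {dilate c b} (λ _ → refl) (dilate-exp-1 c) n ⟨
      (dilate c b ⋆ dilate c (exp 1#)) n      ≡⟨ dilate-⋆ c b (exp 1#) n ⟨
      c ^ n * (b ⋆ exp 1#) n                  ≡⟨ cong (c ^ n *_) (b⋆E n) ⟩
      c ^ n * (b n + X n)                     ≡⟨ distribˡ _ _ _ ⟩
      dilate c b n + dilate c X n             ≡⟨ cong (dilate c b n +_) (dilate-X c n) ⟩
      dilate c b n + c * X n                  ∎
      where open ≡-Reasoning

    reflection : dilate (- 1#) b ≗ b ⊕ X
    reflection = X-cancel λ n → trans (telescoped {β} {X ⋆ E} step n) (last n)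
      where
      β E E⁻ : Seq
      β  = dilate (- 1#) b
      E  = exp 1#
      E⁻ = exp (- 1#)
      step : β ⋆ E ≗ β ⊕ X ⋆ E
      step = begin
        β ⋆ E                     ≈⟨ ⋆-cong {g = E} shifted (λ _ → refl) ⟨
        (β ⋆ E⁻ ⊕ X) ⋆ E          ≈⟨ solveˢ 4 (λ b m x e → (b :*ˢ m :+ˢ x) :*ˢ e :=ˢ b :*ˢ (m :*ˢ e) :+ˢ x :*ˢ e) (λ _ → refl) β E⁻ X E ⟩
        β ⋆ (E⁻ ⋆ E) ⊕ X ⋆ E      ≈⟨ Seq.+-congʳ {X ⋆ E} (⋆-cong {β} (λ _ → refl) (λ n → trans (exp-⋆ (- 1#) 1# n)
                                       (trans (cong (_^ n) (trans (+-comm _ 1#) (-‿inverseʳ 1#))) (exp-0 n)))) ⟩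
        β ⋆ 𝟙 ⊕ X ⋆ E             ≈⟨ Seq.+-congʳ {X ⋆ E} (Seq.*-identityʳ β) ⟩
        β ⊕ X ⋆ E                 ∎
        where
        open Seq-Reasoning
        shifted : β ⋆ E⁻ ⊕ X ≗ β
        shifted n = trans (cong (_+ X n) (dilate-b⋆E (- 1#) n))
          (solve 2 (λ b x → b :+ (:- κ 1) :* x :+ x := b) refl (β n) (X n))
      last : X ⋆ E ⋆ b ≗ X ⋆ (b ⊕ X)
      last = begin
        X ⋆ E ⋆ b      ≈⟨ solveˢ 3 (λ x e b → x :*ˢ e :*ˢ b :=ˢ x :*ˢ (b :*ˢ e)) (λ _ → refl) X E b ⟩
        X ⋆ (b ⋆ E)    ≈⟨ ⋆-cong {X} (λ _ → refl) b⋆E ⟩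
        X ⋆ (b ⊕ X)    ∎
        where open Seq-Reasoning

    [-1]^2n : ∀ n → (- 1#) ^ (2 ℕ.* n) ≡ 1#
    [-1]^2n n = trans (sym (^-assocʳ (- 1#) 2 n)) (trans (cong (_^ n) (solve 0 ((:- κ 1) :* ((:- κ 1) :* κ 1) := κ 1) refl)) (1^ n))

    -- At an odd index above 1 the term t contributes nothing, so `reflection` reads -B = B there.
    b-odd : ∀ n → b (suc (2 ℕ.* suc n)) ≡ 0#
    b-odd n = cancel-suc 1 (begin
      ν 2 * x               ≡⟨ solve 1 (λ x → κ 2 :* x := x :+ κ 0 :- (:- κ 1) :* κ 1 :* x) refl x ⟩
      x + 0# - - 1# * 1# * x  ≡⟨ cong (λ z → x + 0# - - 1# * z * x) ([-1]^2n (suc n)) ⟨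
      x + 0# - dilate (- 1#) b m ≡⟨ cong (λ z → x + 0# - z) (reflection m) ⟩
      x + 0# - (x + 0#)     ≡⟨ solve 1 (λ x → x :+ κ 0 :- (x :+ κ 0) := κ 2 :* κ 0) refl x ⟩
      ν 2 * 0#              ∎)
      where
      open ≡-Reasoning
      m = suc (2 ℕ.* suc n)
      x = b m

    -- The exponential generating function of e is 1/(eᵗ + 1).
    e : Seq
    e n = inv n * ((1# - ν 2 ^ suc n) * b (suc n))

    -- The origin of `e`: t/(eᵗ - 1) - 2t/(e^{2t} - 1) = t/(eᵗ + 1), that is, b(t) - b(2t) = t·e(t).
    X⋆e : X ⋆ e ⊕ dilate (ν 2) b ≗ b
    X⋆e zero    = solve 2 (λ x b → κ 0 :* x :+ κ 1 :* b := b) refl (e 0) (b 0)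
    X⋆e (suc n) = begin
      (X ⋆ e) (suc n) + ν 2 ^ suc n * b (suc n)
        ≡⟨ cong (_+ ν 2 ^ suc n * b (suc n)) (X⋆ e n) ⟩
      ν (suc n) * (inv n * ((1# - ν 2 ^ suc n) * b (suc n))) + ν 2 ^ suc n * b (suc n)
        ≡⟨ solve 4 (λ n i t b → n :* (i :* ((κ 1 :- t) :* b)) :+ t :* b := n :* i :* ((κ 1 :- t) :* b) :+ t :* b) refl (ν (suc n)) (inv n) (ν 2 ^ suc n) (b (suc n)) ⟩
      ν (suc n) * inv n * ((1# - ν 2 ^ suc n) * b (suc n)) + ν 2 ^ suc n * b (suc n)
        ≡⟨ cong (λ z → z * ((1# - ν 2 ^ suc n) * b (suc n)) + ν 2 ^ suc n * b (suc n)) (inv-inverse n) ⟩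
      1# * ((1# - ν 2 ^ suc n) * b (suc n)) + ν 2 ^ suc n * b (suc n)
        ≡⟨ solve 2 (λ t b → κ 1 :* ((κ 1 :- t) :* b) :+ t :* b := b) refl (ν 2 ^ suc n) (b (suc n)) ⟩
      b (suc n) ∎
      where open ≡-Reasoning

    -- From e^{2t} - 1 = (eᵗ - 1)(eᵗ + 1): the left side multiplied by eᵗ - 1 is 2t, and so is 2b.
    dilate-2-b : dilate (ν 2) b ⋆ exp 1# ⊕ dilate (ν 2) b ≗ b ⊕ b
    dilate-2-b = X-cancel λ n → trans (telescoped {g} {X ⊕ X} step n)
      (solveˢ 2 (λ x b → (x :+ˢ x) :*ˢ b :=ˢ x :*ˢ (b :+ˢ b)) (λ _ → refl) X b n)
      where
      β E g : Seq
      β = dilate (ν 2) b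
      E = exp 1#
      g = β ⋆ E ⊕ β
      double : β ⋆ exp (ν 2) ≗ β ⊕ (X ⊕ X)
      double n = trans (dilate-b⋆E (ν 2) n) (solve 2 (λ b x → b :+ κ 2 :* x := b :+ (x :+ x)) refl (β n) (X n))
      step : g ⋆ E ≗ g ⊕ (X ⊕ X)
      step = begin
        g ⋆ E                      ≈⟨ solveˢ 2 (λ b e → (b :*ˢ e :+ˢ b) :*ˢ e :=ˢ b :*ˢ (e :*ˢ e) :+ˢ b :*ˢ e) (λ _ → refl) β E ⟩
        β ⋆ (E ⋆ E) ⊕ β ⋆ E        ≈⟨ Seq.+-congʳ {β ⋆ E} (⋆-cong {β} (λ _ → refl) (λ n → trans (exp-⋆ 1# 1# n) (cong (_^ n) (sym (ν-+ 1 1))))) ⟩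
        β ⋆ exp (ν 2) ⊕ β ⋆ E      ≈⟨ Seq.+-congʳ {β ⋆ E} double ⟩
        β ⊕ (X ⊕ X) ⊕ β ⋆ E        ≈⟨ solveˢ 3 (λ b x e → b :+ˢ (x :+ˢ x) :+ˢ e :=ˢ e :+ˢ b :+ˢ (x :+ˢ x)) (λ _ → refl) β X (β ⋆ E) ⟩
        g ⊕ (X ⊕ X)                ∎
        where open Seq-Reasoning

    e⋆[E+1] : e ⋆ (exp 1# ⊕ 𝟙) ≗ 𝟙
    e⋆[E+1] = X-cancel (⊕-cancelˡ (b ⊕ b) (begin
      b ⊕ b ⊕ X ⋆ (e ⋆ (E ⊕ 𝟙))         ≈⟨ Seq.+-congʳ {X ⋆ (e ⋆ (E ⊕ 𝟙))} dilate-2-b ⟨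
      β ⋆ E ⊕ β ⊕ X ⋆ (e ⋆ (E ⊕ 𝟙))     ≈⟨ Seq.+-congʳ {X ⋆ (e ⋆ (E ⊕ 𝟙))} (Seq.+-congˡ {β ⋆ E} (Seq.*-identityʳ β)) ⟨
      β ⋆ E ⊕ β ⋆ 𝟙 ⊕ X ⋆ (e ⋆ (E ⊕ 𝟙)) ≈⟨ solveˢ 5 (λ b E x e u → b :*ˢ E :+ˢ b :*ˢ u :+ˢ x :*ˢ (e :*ˢ (E :+ˢ u)) :=ˢ (x :*ˢ e :+ˢ b) :*ˢ (E :+ˢ u)) (λ _ → refl) β E X e 𝟙 ⟩
      (X ⋆ e ⊕ β) ⋆ (E ⊕ 𝟙)             ≈⟨ ⋆-cong {g = E ⊕ 𝟙} X⋆e (λ _ → refl) ⟩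
      b ⋆ (E ⊕ 𝟙)                       ≈⟨ ⋆-distribˡ b E 𝟙 ⟩
      b ⋆ E ⊕ b ⋆ 𝟙                     ≈⟨ Seq.+-cong b⋆E (Seq.*-identityʳ b) ⟩
      b ⊕ X ⊕ b                         ≈⟨ solveˢ 2 (λ b x → b :+ˢ x :+ˢ b :=ˢ b :+ˢ b :+ˢ x) (λ _ → refl) b X ⟩
      b ⊕ b ⊕ X                         ≈⟨ Seq.+-congˡ {b ⊕ b} (Seq.*-identityʳ X) ⟨
      b ⊕ b ⊕ X ⋆ 𝟙                     ∎))
      where
      open Seq-Reasoning
      β E : Seq
      β = dilate (ν 2) b
      E = exp 1#

    -- For an odd number N of terms the alternating sum times eᵗ + 1 is 1 + e^{Nt}; multiplying by e
    -- = 1/(eᵗ + 1) isolates the sum.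
    altPowerSum-e : ∀ h n → altPowerSum (suc (2 ℕ.* h)) n ≡ e n + (exp (ν (suc (2 ℕ.* h))) ⋆ e) n
    altPowerSum-e h = begin
      T                            ≈⟨ Seq.*-identityʳ T ⟨
      T ⋆ 𝟙                        ≈⟨ ⋆-cong {T} (λ _ → refl) e⋆[E+1] ⟨
      T ⋆ (e ⋆ (exp 1# ⊕ 𝟙))       ≈⟨ solveˢ 3 (λ t e u → t :*ˢ (e :*ˢ u) :=ˢ e :*ˢ (t :*ˢ u)) (λ _ → refl) T e (exp 1# ⊕ 𝟙) ⟩
      e ⋆ (T ⋆ (exp 1# ⊕ 𝟙))       ≈⟨ ⋆-cong {e} (λ _ → refl) step ⟩
      e ⋆ (𝟙 ⊕ exp (ν N))          ≈⟨ ⋆-distribˡ e 𝟙 (exp (ν N)) ⟩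
      e ⋆ 𝟙 ⊕ e ⋆ exp (ν N)        ≈⟨ Seq.+-cong (Seq.*-identityʳ e) (⋆-comm e (exp (ν N))) ⟩
      e ⊕ exp (ν N) ⋆ e            ∎
      where
      open Seq-Reasoning
      N = suc (2 ℕ.* h)
      T = altPowerSum N
      step : T ⋆ (exp 1# ⊕ 𝟙) ≗ 𝟙 ⊕ exp (ν N)
      step n = trans (trans (solve 2 (λ t x → t := t :+ (:- κ 1) :* κ 1 :* x :+ x) refl ((T ⋆ (exp 1# ⊕ 𝟙)) n) (ν N ^ n))
        (cong (λ z → (T ⋆ (exp 1# ⊕ 𝟙)) n + - 1# * z * ν N ^ n + ν N ^ n) (sym ([-1]^2n h))))
        (cong (_+ ν N ^ n) (altPowerSum-E N n))

  -- Integrality and divisibility at p, with M = p - 1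

  module Local (M : ℕ) (p-prime : Prime (suc M)) where

    p : ℕ
    p = suc M

    P : K
    P = ν p

    -- Any denominator prime to p is accepted, reduced or not. Sums and products then just multiply
    -- denominators, and Euclid's lemma keeps these prime to p.
    record Int (x : K) : Set where
      constructor mkInt
      field
        den     : ℕ
        num     : ℤ
        p∤den   : ¬ p ∣ den
        cleared : ν den * x ≡ ι num

    p∤* : ∀ {m n} → ¬ p ∣ m → ¬ p ∣ n → ¬ p ∣ m ℕ.* n
    p∤* p∤m p∤n p∣mn = [ p∤m , p∤n ]′ (euclidsLemma _ _ p-prime p∣mn)

    p∤small : ∀ {n} → suc n < p → ¬ p ∣ suc n
    p∤small n<p = >⇒∤ n<p

    Int-ι : ∀ i → Int (ι i)
    Int-ι i = mkInt 1 i (p∤small 1<p) (*-identityˡ (ι i))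
      where
      1<p : 1 < p
      1<p = ℕ.nonTrivial⇒n>1 p {{prime⇒nonTrivial p-prime}}

    Int-ν : ∀ n → Int (ν n)
    Int-ν n = Int-ι (pos n)

    Int-P : Int P
    Int-P = Int-ν p

    Int-+ : ∀ {x y} → Int x → Int y → Int (x + y)
    Int-+ {x} {y} (mkInt d n p∤d eq) (mkInt d′ n′ p∤d′ eq′) =
      mkInt (d ℕ.* d′) (n ℤ.* pos d′ ℤ.+ n′ ℤ.* pos d) (p∤* p∤d p∤d′) (begin
        ν (d ℕ.* d′) * (x + y)                   ≡⟨ cong (_* (x + y)) (ν-* d d′) ⟩
        ν d * ν d′ * (x + y)                     ≡⟨ solve 4 (λ d e x y → d :* e :* (x :+ y) := d :* x :* e :+ e :* y :* d) refl (ν d) (ν d′) x y ⟩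
        ν d * x * ν d′ + ν d′ * y * ν d          ≡⟨ cong₂ (λ u v → u * ν d′ + v * ν d) eq eq′ ⟩
        ι n * ν d′ + ι n′ * ν d                  ≡⟨ cong₂ _+_ (ι-* n (pos d′)) (ι-* n′ (pos d)) ⟨
        ι (n ℤ.* pos d′) + ι (n′ ℤ.* pos d)      ≡⟨ ι-+ _ _ ⟨
        ι (n ℤ.* pos d′ ℤ.+ n′ ℤ.* pos d)        ∎)
      where open ≡-Reasoning

    Int-* : ∀ {x y} → Int x → Int y → Int (x * y)
    Int-* {x} {y} (mkInt d n p∤d eq) (mkInt d′ n′ p∤d′ eq′) =
      mkInt (d ℕ.* d′) (n ℤ.* n′) (p∤* p∤d p∤d′) (begin
        ν (d ℕ.* d′) * (x * y)     ≡⟨ cong (_* (x * y)) (ν-* d d′) ⟩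
        ν d * ν d′ * (x * y)       ≡⟨ solve 4 (λ d e x y → d :* e :* (x :* y) := d :* x :* (e :* y)) refl (ν d) (ν d′) x y ⟩
        ν d * x * (ν d′ * y)       ≡⟨ cong₂ _*_ eq eq′ ⟩
        ι n * ι n′                 ≡⟨ ι-* n n′ ⟨
        ι (n ℤ.* n′)               ∎)
      where open ≡-Reasoning

    Int-neg : ∀ {x} → Int x → Int (- x)
    Int-neg {x} ix = subst Int (solve 1 (λ x → (:- κ 1) :* x := :- x) refl x) (Int-* (subst Int (ι-neg (pos 1)) (Int-ι (ℤ.- pos 1))) ix)

    Int-^ : ∀ {x} n → Int x → Int (x ^ n)
    Int-^ zero    ix = Int-ν 1
    Int-^ (suc n) ix = Int-* ix (Int-^ n ix)

    Int-unit : ∀ {n x} → ¬ p ∣ n → Int (ν n * x) → Int x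
    Int-unit {n} {x} p∤n (mkInt d k p∤d eq) = mkInt (d ℕ.* n) k (p∤* p∤d p∤n)
      (trans (cong (_* x) (ν-* d n)) (trans (*-assoc (ν d) (ν n) x) eq))

    Int-inv : ∀ {n} → ¬ p ∣ suc n → Int (inv n)
    Int-inv {n} p∤n = Int-unit p∤n (subst Int (sym (inv-inverse n)) (Int-ν 1))

    Int-∑ : ∀ n {f : ℕ → K} → (∀ k → k < n → Int (f k)) → Int (∑ n f)
    Int-∑ zero    h = Int-ν 0
    Int-∑ (suc n) h = Int-+ (Int-∑ n λ k k<n → h k (ℕP.m<n⇒m<1+n k<n)) (h n ℕP.≤-refl)

    record Div (e : ℕ) (x : K) : Set where
      constructor mkDiv
      field
        quot   : K
        int    : Int quot
        eq     : x ≡ P ^ e * quot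

    Div⇒Int : ∀ {e x} → Div e x → Int x
    Div⇒Int {e} (mkDiv z iz eq) = subst Int (sym eq) (Int-* (Int-^ e (Int-ν p)) iz)

    Int⇒Div0 : ∀ {x} → Int x → Div 0 x
    Int⇒Div0 {x} ix = mkDiv x ix (sym (*-identityˡ x))

    Div-+ : ∀ {e x y} → Div e x → Div e y → Div e (x + y)
    Div-+ (mkDiv z iz eq) (mkDiv z′ iz′ eq′) =
      mkDiv (z + z′) (Int-+ iz iz′) (trans (cong₂ _+_ eq eq′) (sym (distribˡ _ z z′)))

    Div-* : ∀ {e e′ x y} → Div e x → Div e′ y → Div (e ℕ.+ e′) (x * y)
    Div-* {e} {e′} (mkDiv z iz eq) (mkDiv z′ iz′ eq′) = mkDiv (z * z′) (Int-* iz iz′) (trans (cong₂ _*_ eq eq′)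
      (trans (solve 4 (λ a b c d → a :* b :* (c :* d) := a :* c :* (b :* d)) refl (P ^ e) z (P ^ e′) z′)
             (cong (_* (z * z′)) (sym (^-homo-* P e e′)))))

    infixr 7 _·_
    _·_ : ∀ {e c x} → Int c → Div e x → Div e (c * x)
    ic · dx = Div-* (Int⇒Div0 ic) dx

    Div-neg : ∀ {e x} → Div e x → Div e (- x)
    Div-neg {e} (mkDiv z iz eq) = mkDiv (- z) (Int-neg iz)
      (trans (cong -_ eq) (solve 2 (λ q z → :- (q :* z) := q :* (:- z)) refl (P ^ e) z))

    infixl 6 _⊖_
    _⊖_ : ∀ {e x y} → Div e x → Div e y → Div e (x - y)
    dx ⊖ dy = Div-+ dx (Div-neg dy)

    Div-P^ : ∀ e → Div e (P ^ e)
    Div-P^ e = mkDiv 1# (Int-ν 1) (sym (trans (*-comm _ 1#) (*-identityˡ _)))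

    Div-P : Div 1 P
    Div-P = subst (Div 1) (solve 1 (λ p → p :* κ 1 := p) refl P) (Div-P^ 1)

    Div-weaken : ∀ e e′ {x} → Div (e ℕ.+ e′) x → Div e x
    Div-weaken e e′ (mkDiv z iz eq) = mkDiv (P ^ e′ * z) (Int-* (Int-^ e′ (Int-ν p)) iz)
      (trans eq (trans (cong (_* z) (^-homo-* P e e′)) (*-assoc _ _ z)))

    Div-unit : ∀ {e n x} → ¬ p ∣ suc n → Div e (ν (suc n) * x) → Div e x
    Div-unit {e} {n} {x} p∤n dx = subst (Div e)
      (trans (sym (*-assoc _ _ x)) (trans (cong (_* x) (trans (*-comm _ _) (inv-inverse n))) (*-identityˡ x)))
      (Int-inv p∤n · dx)

    Div-0 : ∀ {e} → Div e 0#
    Div-0 {e} = mkDiv 0# (Int-ν 0) (sym (zeroʳ (P ^ e)))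

    Div-∑ : ∀ {e} n {f : ℕ → K} → (∀ k → k < n → Div e (f k)) → Div e (∑ n f)
    Div-∑ zero    h = Div-0
    Div-∑ (suc n) h = Div-+ (Div-∑ n λ k k<n → h k (ℕP.m<n⇒m<1+n k<n)) (h n ℕP.≤-refl)

    -- The bound means v_p(k + 1) ≤ j. Each factor p removed from k + 1 consumes one factor of p^j;
    -- when none is left, k + 1 < p is a unit.
    Int-P^*inv : ∀ j {k} → suc k < p ℕ.^ suc j → Int (P ^ j * inv k)
    Int-P^*inv j {k} k< with p ∣? suc k
    ... | no  p∤k                 = Int-* (Int-^ j (Int-ν p)) (Int-inv p∤k)
    Int-P^*inv zero    {k} k<  | yes p∣k = contradiction p∣k (p∤small (subst (suc k <_) (ℕP.*-identityʳ p) k<))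
    Int-P^*inv (suc j) {k} k<  | yes (divides (suc q) eq) = subst Int same (Int-P^*inv j {q} q<)
      where
      q< : suc q < p ℕ.^ suc j
      q< = ℕP.*-cancelˡ-< p _ _ (subst (_< p ℕ.^ suc (suc j)) (trans eq (ℕP.*-comm (suc q) p)) k<)
      same : P ^ j * inv q ≡ P ^ suc j * inv k
      same = cancel-suc k (begin
        ν (suc k) * (P ^ j * inv q)          ≡⟨ cong (_* (P ^ j * inv q)) (trans (cong ν eq) (ν-* (suc q) p)) ⟩
        ν (suc q) * P * (P ^ j * inv q)      ≡⟨ solve 4 (λ s p j i → s :* p :* (j :* i) := p :* j :* (s :* i)) refl (ν (suc q)) P (P ^ j) (inv q) ⟩
        P ^ suc j * (ν (suc q) * inv q)      ≡⟨ cong (P ^ suc j *_) (trans (inv-inverse q) (sym (inv-inverse k))) ⟩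
        P ^ suc j * (ν (suc k) * inv k)      ≡⟨ solve 3 (λ a b c → a :* (b :* c) := b :* (a :* c)) refl (P ^ suc j) (ν (suc k)) (inv k) ⟩
        ν (suc k) * (P ^ suc j * inv k)      ∎)
        where open ≡-Reasoning

    -- The estimate behind the tails of Faulhaber's formula: of p^{k+1}/(k+1) one factor p is
    -- reserved for making pB integral, and what is left is still divisible by p^e for every k ≥ e.
    Div-P^*inv : ∀ e j → suc e < p → Div e (P ^ (e ℕ.+ j) * inv (e ℕ.+ j))
    Div-P^*inv e j e<p = mkDiv (P ^ j * inv (e ℕ.+ j)) (Int-P^*inv j (p^-growth e j e<p))
      (trans (cong (_* inv (e ℕ.+ j)) (^-homo-* P e j)) (*-assoc _ _ _))

    Div-C : ∀ k → k < M → Div 1 (ν (p C suc k))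
    Div-C k k<M = subst (Div 1) (cancel-suc k (begin
        ν (suc k) * (inv k * ν (M C k) * P)
          ≡⟨ solve 4 (λ s i c p → s :* (i :* c :* p) := s :* i :* (p :* c)) refl (ν (suc k)) (inv k) (ν (M C k)) P ⟩
        ν (suc k) * inv k * (P * ν (M C k))
          ≡⟨ trans (cong (_* (P * ν (M C k))) (inv-inverse k)) (*-identityˡ _) ⟩
        P * ν (M C k)
          ≡⟨ ν-* p (M C k) ⟨
        ν (p ℕ.* (M C k))
          ≡⟨ cong ν (C-absorb M k) ⟨
        ν (suc k ℕ.* (p C suc k))
          ≡⟨ ν-* (suc k) (p C suc k) ⟩
        ν (suc k) * ν (p C suc k) ∎))
      (Int-* (Int-inv (p∤small (s≤s k<M))) (Int-ν (M C k)) · Div-P)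
      where open ≡-Reasoning

    fermat : ∀ a → Div 1 (ν a ^ p - ν a)
    fermat zero    = subst (Div 1) (solve 1 (λ x → κ 0 := κ 0 :* x :- κ 0) refl (0# ^ M)) Div-0
    fermat (suc a) = subst (Div 1) (sym split) (Div-+ (fermat a)
        (Div-∑ M λ k k<M → subst (Div 1) (*-comm _ _) (Int-* (Int-^ (suc k) (Int-ν 1)) (Int-^ (M ∸ k) (Int-ν a)) · Div-C k k<M)))
      where
      open ≡-Reasoning
      mid : K
      mid = ∑ M (λ k → ν (p C suc k) * (1# ^ suc k * ν a ^ (M ∸ k)))
      split : ν (suc a) ^ p - ν (suc a) ≡ ν a ^ p - ν a + mid
      split = begin
        ν (suc a) ^ p - ν (suc a)
          ≡⟨ cong (λ z → z ^ p - z) (ν-suc a) ⟩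
        (1# + ν a) ^ p - (1# + ν a)
          -- The binomial theorem, read off as the coefficient at index p of eᵗ·e^{at} = e^{(1+a)t}.
          ≡⟨ cong (_- (1# + ν a)) (trans (sym (exp-⋆ 1# (ν a) p)) (⋆-formula (exp 1#) (exp (ν a)) p)) ⟩
        ∑ p (λ k → ν (p C k) * (1# ^ k * ν a ^ (p ∸ k))) + ν (p C p) * (1# ^ p * ν a ^ (p ∸ p)) - (1# + ν a)
          ≡⟨ cong₂ (λ x y → x + y - (1# + ν a)) (∑-front M _)
               (cong₂ _*_ (cong ν (nCn≡1 p)) (cong₂ _*_ (1^ p) (cong (ν a ^_) (ℕP.n∸n≡0 p)))) ⟩
        1# * (1# * ν a ^ p) + mid + 1# * (1# * 1#) - (1# + ν a)
          ≡⟨ solve 3 (λ x m a → κ 1 :* (κ 1 :* x) :+ m :+ κ 1 :* (κ 1 :* κ 1) :- (κ 1 :+ a) := x :- a :+ m) refl (ν a ^ p) mid (ν a) ⟩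
        ν a ^ p - ν a + mid ∎

    fermat-unit : ∀ a → suc a < p → Div 1 (ν (suc a) ^ M - 1#)
    fermat-unit a a<p = Div-unit (p∤small a<p) (subst (Div 1)
      (solve 2 (λ a x → a :* x :- a := a :* (x :- κ 1)) refl (ν (suc a)) (ν (suc a) ^ M)) (fermat (suc a)))

    -- If z = (3 + w) z − w z with w ∈ p ℤ_p, then each power of p dividing (3 + w) z passes to z one step at a time.
    Int-descent : ∀ {w z} k → ¬ p ∣ 3 → Div 1 w → Int ((ν 3 + w) * z) → Int (P ^ k * z) → Int z
    Int-descent {w} {z} zero    p∤3 dw il iz = subst Int (*-identityˡ z) iz
    Int-descent {w} {z} (suc k) p∤3 dw@(mkDiv v iv eq) il iz = Int-descent k p∤3 dw il (Int-unit p∤3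
      (subst Int (begin
        P ^ k * ((ν 3 + w) * z) - v * (P ^ suc k * z)
          ≡⟨ solve 5 (λ q w z v p → q :* ((κ 3 :+ w) :* z) :- v :* (p :* q :* z) := κ 3 :* (q :* z) :+ (w :- p :* κ 1 :* v) :* q :* z) refl (P ^ k) w z v P ⟩
        ν 3 * (P ^ k * z) + (w - P ^ 1 * v) * P ^ k * z
          ≡⟨ cong (λ y → ν 3 * (P ^ k * z) + (y - P ^ 1 * v) * P ^ k * z) eq ⟩
        ν 3 * (P ^ k * z) + (P ^ 1 * v - P ^ 1 * v) * P ^ k * z
          ≡⟨ solve 4 (λ a c q z → a :+ (c :- c) :* q :* z := a) refl (ν 3 * (P ^ k * z)) (P ^ 1 * v) (P ^ k) z ⟩
        ν 3 * (P ^ k * z) ∎)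
        (Int-+ (Int-* (Int-^ k (Int-ν p)) il) (Int-neg (Int-* iv iz)))))
      where open ≡-Reasoning

    -- Faulhaber's formula modulo powers of p

    module Congruences (5<p : 5 < suc M) (b : Seq) (b-zero : b 0 ≡ 1#)
      (b-rec : ∀ n → ∑ (suc (suc n)) (λ k → ν (suc (suc n) C k) * b k) ≡ 0#) where

      open Bernoulli b b-zero b-rec

      -- The extreme case n = 4 is where p > 5 enters: the tail modulo p⁴ begins with p⁵/5, and 5
      -- must be a unit.
      <p : ∀ {n} → n ≤ 4 → suc n < p
      <p n≤4 = ℕP.≤-<-trans (s≤s n≤4) 5<p

      p∤2 : ¬ p ∣ 2
      p∤2 = p∤small (<p (s≤s z≤n))

      p∤3 : ¬ p ∣ 3
      p∤3 = p∤small (<p (s≤s (s≤s z≤n)))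

      p∤6 : ¬ p ∣ 6
      p∤6 = p∤* {2} {3} p∤2 p∤3

      p∤4 : ¬ p ∣ 4
      p∤4 = p∤* {2} {2} p∤2 p∤2

      p∤12 : ¬ p ∣ 12
      p∤12 = p∤* {4} {3} p∤4 p∤3

      S : Seq
      S = powerSum p

      term : ℕ → ℕ → K
      term n k = ν (n C k) * (powerQuotient P k * b (n ∸ k))

      -- Each term is regrouped as p^k/(k+1) times pB. Integrality is asked only for the indices up
      -- to r that occur, which allows the use inside the induction for `Int-Pb`.
      Div-tail : ∀ e r → suc e < p → (∀ j → j ≤ r → Int (P * b j)) →
        Div e (∑ (suc r) (λ k → term (e ℕ.+ r) (e ℕ.+ k)))
      Div-tail e r e<p ib = Div-∑ (suc r) λ k k≤r → subst (Div e)
        (trans (solve 5 (λ c p b q i → c :* (p :* b) :* (q :* i) := c :* (p :* q :* i :* b)) refl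
                 (ν ((e ℕ.+ r) C (e ℕ.+ k))) P (b (r ∸ k)) (P ^ (e ℕ.+ k)) (inv (e ℕ.+ k)))
               (cong (λ z → ν ((e ℕ.+ r) C (e ℕ.+ k)) * (powerQuotient P (e ℕ.+ k) * b z)) (sym (ℕP.[m+n]∸[m+o]≡n∸o e r k))))
        (Int-* (Int-ν ((e ℕ.+ r) C (e ℕ.+ k))) (ib (r ∸ k) (ℕP.m∸n≤m r k)) · Div-P^*inv e k e<p)

      S-peel₁ : ∀ r → S (suc r) ≡ P * b (suc r) + ∑ (suc r) (λ k → term (suc r) (suc k))
      S-peel₁ r = begin
        S (suc r)
          ≡⟨ trans (faulhaber p (suc r)) (⋆-formula (powerQuotient P) b (suc r)) ⟩
        ∑ (suc (suc r)) (term (suc r))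
          ≡⟨ ∑-front (suc r) (term (suc r)) ⟩
        1# * (P * 1# * inv 0 * b (suc r)) + ∑ (suc r) (λ k → term (suc r) (suc k))
          ≡⟨ cong (_+ ∑ (suc r) (λ k → term (suc r) (suc k)))
               (trans (solve 3 (λ p i b → κ 1 :* (p :* κ 1 :* i :* b) := p :* (κ 1 :* i) :* b) refl P (inv 0) (b (suc r)))
                 (trans (cong (λ z → P * z * b (suc r)) (inv-inverse 0))
                   (solve 2 (λ p b → p :* κ 1 :* b := p :* b) refl P (b (suc r))))) ⟩
        P * b (suc r) + ∑ (suc r) (λ k → term (suc r) (suc k)) ∎
        where open ≡-Reasoning

      term-zero : ∀ n k → b (n ∸ k) ≡ 0# → term n k ≡ 0#
      term-zero n k eq = trans (cong (λ z → ν (n C k) * (powerQuotient P k * z)) eq)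
        (trans (cong (ν (n C k) *_) (zeroʳ _)) (zeroʳ _))

      S-peel₂ : ∀ r → b (suc r) ≡ 0# → S (2 ℕ.+ r) ≡ P * b (2 ℕ.+ r) + ∑ (suc r) (λ k → term (2 ℕ.+ r) (2 ℕ.+ k))
      S-peel₂ r b≡0 = trans (S-peel₁ (suc r)) (cong (P * b (2 ℕ.+ r) +_) (trans (∑-front (suc r) _)
        (trans (cong (_+ ∑ (suc r) (λ k → term (2 ℕ.+ r) (2 ℕ.+ k))) (term-zero (2 ℕ.+ r) 1 b≡0)) (+-identityˡ _))))

      -- The terms k = 1 and k = 3 carry the two vanishing Bernoulli numbers, so k = 2 is the only
      -- correction before the tail divisible by p⁴.
      S-peel₄ : ∀ r → b (suc r) ≡ 0# → b (3 ℕ.+ r) ≡ 0# →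
        S (4 ℕ.+ r) ≡ P * b (4 ℕ.+ r) + (term (4 ℕ.+ r) 2 + ∑ (suc r) (λ k → term (4 ℕ.+ r) (4 ℕ.+ k)))
      S-peel₄ r b₁≡0 b₃≡0 = trans (S-peel₂ (2 ℕ.+ r) b₃≡0) (cong (P * b (4 ℕ.+ r) +_) (trans (∑-front (2 ℕ.+ r) _)
        (cong (term (4 ℕ.+ r) 2 +_) (trans (∑-front (1 ℕ.+ r) _)
          (trans (cong (_+ ∑ (suc r) (λ k → term (4 ℕ.+ r) (4 ℕ.+ k))) (term-zero (4 ℕ.+ r) 3 b₁≡0)) (+-identityˡ _))))))

      Int-S : ∀ n → Int (S n)
      Int-S n = Int-∑ p λ a _ → Int-^ n (Int-ν a)

      -- The integral half of von Staudt-Clausen by strong induction: in Faulhaber's formula pB_n is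
      -- an integer minus a tail in which only earlier Bernoulli numbers occur.
      Int-Pb : ∀ n → Int (P * b n)
      Int-Pb n = below (suc n) n ℕP.≤-refl
        where
        below : ∀ N n → n < N → Int (P * b n)
        below (suc N) zero    _         = Int-* (Int-ν p) (subst Int (sym b-zero) (Int-ν 1))
        below (suc N) (suc r) (s≤s r<N) = subst Int
          (trans (cong (_- ∑ (suc r) (λ k → term (suc r) (suc k))) (S-peel₁ r))
            (solve 2 (λ x y → x :+ y :- y := x) refl (P * b (suc r)) _))
          (Int-+ (Int-S (suc r)) (Int-neg (Div⇒Int (Div-tail 1 r (<p (s≤s z≤n)) λ j j≤r → below N j (ℕP.≤-<-trans j≤r r<N)))))

      S≡Pb-mod-p : ∀ r → Div 1 (S (suc r) - P * b (suc r))
      S≡Pb-mod-p r = subst (Div 1)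
        (trans (solve 2 (λ x y → y := x :+ y :- x) refl (P * b (suc r)) _) (cong (_- P * b (suc r)) (sym (S-peel₁ r))))
        (Div-tail 1 r (<p (s≤s z≤n)) λ j _ → Int-Pb j)

      S≡Pb-mod-p² : ∀ r → b (suc r) ≡ 0# → Div 2 (S (2 ℕ.+ r) - P * b (2 ℕ.+ r))
      S≡Pb-mod-p² r b≡0 = subst (Div 2)
        (trans (solve 2 (λ x y → y := x :+ y :- x) refl (P * b (2 ℕ.+ r)) _) (cong (_- P * b (2 ℕ.+ r)) (sym (S-peel₂ r b≡0))))
        (Div-tail 2 r (<p (s≤s (s≤s z≤n))) λ j _ → Int-Pb j)

      2*C2 : ∀ n → ν 2 * ν (suc n C 2) ≡ ν (suc n) * ν n
      2*C2 n = trans (sym (ν-* 2 _)) (trans (cong ν (trans (C-absorb n 1) (cong (suc n ℕ.*_) (nC1≡n n)))) (ν-* (suc n) n))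

      -- The term k = 2 is C(n,2)·p³/3·B_{n-2} = n(n-1)/6·p²·pB_{n-2}; the factor 6 keeps the
      -- formula free of denominators.
      S-mod-p⁴ : ∀ r → b (suc r) ≡ 0# → b (3 ℕ.+ r) ≡ 0# → let n = 4 ℕ.+ r in
        Div 4 (ν 6 * S n - (ν 6 * (P * b n) + P * P * (ν n * (ν n - 1#)) * (P * b (2 ℕ.+ r))))
      S-mod-p⁴ r b₁≡0 b₃≡0 = subst (Div 4) (begin
          ν 6 * t
            ≡⟨ solve 3 (λ t B c → κ 6 :* t := κ 6 :* (B :+ (c :+ t)) :- (κ 6 :* B :+ κ 6 :* c)) refl t (P * b n) (term n 2) ⟩
          ν 6 * (P * b n + (term n 2 + t)) - (ν 6 * (P * b n) + ν 6 * term n 2)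
            ≡⟨ cong₂ (λ x y → ν 6 * x - (ν 6 * (P * b n) + y)) (sym (S-peel₄ r b₁≡0 b₃≡0)) quadratic ⟩
          ν 6 * S n - (ν 6 * (P * b n) + P * P * (ν n * (ν n - 1#)) * (P * b (2 ℕ.+ r))) ∎)
        (Int-ν 6 · Div-tail 4 r (<p ℕP.≤-refl) λ j _ → Int-Pb j)
        where
        open ≡-Reasoning
        n = 4 ℕ.+ r
        t = ∑ (suc r) (λ k → term n (4 ℕ.+ k))
        quadratic : ν 6 * term n 2 ≡ P * P * (ν n * (ν n - 1#)) * (P * b (2 ℕ.+ r))
        quadratic = begin
          ν 6 * (ν (n C 2) * (P ^ 3 * inv 2 * b (2 ℕ.+ r)))
            ≡⟨ solve 4 (λ c p i b → κ 6 :* (c :* (p :* (p :* (p :* κ 1)) :* i :* b)) := κ 2 :* c :* (κ 3 :* i) :* (p :* p) :* (p :* b)) refl (ν (n C 2)) P (inv 2) (b (2 ℕ.+ r)) ⟩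
          ν 2 * ν (n C 2) * (ν 3 * inv 2) * (P * P) * (P * b (2 ℕ.+ r))
            ≡⟨ cong₂ (λ x y → x * y * (P * P) * (P * b (2 ℕ.+ r))) (2*C2 (3 ℕ.+ r)) (inv-inverse 2) ⟩
          ν n * ν (3 ℕ.+ r) * 1# * (P * P) * (P * b (2 ℕ.+ r))
            ≡⟨ cong (λ z → ν n * z * 1# * (P * P) * (P * b (2 ℕ.+ r))) (trans (solve 1 (λ x → x := κ 1 :+ x :- κ 1) refl (ν (3 ℕ.+ r))) (cong (_- 1#) (sym (ν-suc (3 ℕ.+ r))))) ⟩
          ν n * (ν n - 1#) * 1# * (P * P) * (P * b (2 ℕ.+ r))
            ≡⟨ solve 4 (λ n m p x → n :* m :* κ 1 :* (p :* p) :* x := p :* p :* (n :* m) :* x) refl (ν n) (ν n - 1#) P (P * b (2 ℕ.+ r)) ⟩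
          P * P * (ν n * (ν n - 1#)) * (P * b (2 ℕ.+ r)) ∎

      -- Sharper than `Int-Pb` for small indices: there the Bernoulli recurrence divides only by
      -- numbers below p.
      Int-b : ∀ n → suc n < p → Int (b n)
      Int-b n = below (suc n) n ℕP.≤-refl
        where
        below : ∀ N n → n < N → suc n < p → Int (b n)
        below (suc N) zero    _         _   = subst Int (sym b-zero) (Int-ν 1)
        below (suc N) (suc n) (s≤s n<N) n<p = Int-unit (p∤small n<p) (subst Int (begin
            - ∑ (suc n) f
              ≡⟨ solve 2 (λ s x → :- s := x :- (s :+ x)) refl (∑ (suc n) f) (ν c * b (suc n)) ⟩
            ν c * b (suc n) - (∑ (suc n) f + ν c * b (suc n))
              ≡⟨ cong₂ (λ x y → ν x * b (suc n) - y) top (b-rec n) ⟩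
            ν (suc (suc n)) * b (suc n) - 0#
              ≡⟨ solve 1 (λ x → x :- κ 0 := x) refl (ν (suc (suc n)) * b (suc n)) ⟩
            ν (suc (suc n)) * b (suc n) ∎)
          (Int-neg (Int-∑ (suc n) λ k k≤n → Int-* (Int-ν (suc (suc n) C k))
            (below N k (ℕP.<-≤-trans k≤n n<N) (ℕP.<-trans (s≤s k≤n) n<p)))))
          where
          open ≡-Reasoning
          f : ℕ → K
          f k = ν (suc (suc n) C k) * b k
          c = suc (suc n) C suc n
          top : c ≡ suc (suc n)
          top = trans (nCk≡nC[n∸k] (ℕP.n≤1+n (suc n))) (trans (cong (suc (suc n) C_) (ℕP.m+n∸n≡m 1 n)) (nC1≡n (suc (suc n))))

      Div-S : ∀ r → suc (suc r) < p → Div 1 (S (suc r))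
      Div-S r r<p = subst (Div 1) (solve 2 (λ s x → s :- x :+ x := s) refl (S (suc r)) (P * b (suc r)))
        (Div-+ (S≡Pb-mod-p r) (subst (Div 1) (*-comm _ _) (Int-b (suc r) r<p · Div-P)))

      -- The definition of `e` divides by n + 1, but the recurrence contained in e·(eᵗ + 1) = 1
      -- divides by 2 only.
      Int-e : ∀ n → Int (e n)
      Int-e n = below (suc n) n ℕP.≤-refl
        where
        below : ∀ N n → n < N → Int (e n)
        below (suc N) n (s≤s n≤N) = Int-unit p∤2 (subst Int (begin
            𝟙 n - t
              ≡⟨ cong (_- t) (sym (trans (⋆-comm (exp 1# ⊕ 𝟙) e n) (e⋆[E+1] n))) ⟩
            ((exp 1# ⊕ 𝟙) ⋆ e) n - t
              ≡⟨ cong (_- t) (trans (⋆-distribʳ e (exp 1#) 𝟙 n) (cong₂ _+_ (trans (⋆-formula (exp 1#) e n) (∑-front n _)) (⋆-identityˡ e n))) ⟩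
            1# * (1# * e n) + t + e n - t
              ≡⟨ solve 2 (λ e t → κ 1 :* (κ 1 :* e) :+ t :+ e :- t := κ 2 :* e) refl (e n) t ⟩
            ν 2 * e n ∎)
          (Int-+ (Int-𝟙 n) (Int-neg (Int-∑ n λ k k<n → Int-* (Int-ν (n C suc k)) (Int-* (Int-^ (suc k) (Int-ν 1))
            (below N (n ∸ suc k) (ℕP.<-≤-trans (ℕP.∸-monoʳ-< {n} {suc k} {0} (s≤s z≤n) k<n) n≤N)))))))
          where
          open ≡-Reasoning
          t = ∑ n (λ k → ν (n C suc k) * (1# ^ suc k * e (n ∸ suc k)))
          Int-𝟙 : ∀ n → Int (𝟙 n)
          Int-𝟙 zero    = Int-ν 1
          Int-𝟙 (suc n) = Int-ν 0

      -- Alternating power sums modulo p and p³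

      module _ (h : ℕ) (M≡2h : M ≡ 2 ℕ.* h) where

        T : Seq
        T = altPowerSum p

        T-formula : ∀ n → T n ≡ e n + ∑ (suc n) (λ k → ν (n C k) * (P ^ k * e (n ∸ k)))
        T-formula n = trans (subst (λ N → altPowerSum (suc N) n ≡ e n + (exp (ν (suc N)) ⋆ e) n) (sym M≡2h) (altPowerSum-e h n))
          (cong (e n +_) (⋆-formula (exp P) e n))

        T-mod-p : ∀ n → Div 1 (T n - ν 2 * e n)
        T-mod-p n = subst (Div 1) (sym (trans (cong (_- ν 2 * e n) (trans (T-formula n) (cong (e n +_) (∑-front n _))))
            (solve 2 (λ e t → e :+ (κ 1 :* (κ 1 :* e) :+ t) :- κ 2 :* e := t) refl (e n) _)))
          (Div-∑ n λ k _ → Int-ν (n C suc k) · subst (Div 1)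
            (solve 3 (λ p q e → q :* e :* p := p :* q :* e) refl P (P ^ k) (e (n ∸ suc k)))
            (Int-* (Int-^ k (Int-ν p)) (Int-e (n ∸ suc k)) · Div-P))

        T-mod-p³ : ∀ r → b (3 ℕ.+ r) ≡ 0# → let n = 3 ℕ.+ r in
          Div 3 (ν 2 * T n - (ν 4 * e n + P * P * (ν n * (ν n - 1#)) * e (1 ℕ.+ r)))
        T-mod-p³ r b≡0 = subst (Div 3) (begin
            ν 2 * t
              ≡⟨ solve 4 (λ t e p q → κ 2 :* t := κ 2 :* (e :+ (κ 1 :* (κ 1 :* e) :+ (p :* κ 0 :+ (q :+ t)))) :- (κ 4 :* e :+ κ 2 :* q)) refl
                   t (e n) (ν (n C 1) * (P ^ 1)) (ν (n C 2) * (P ^ 2 * e (1 ℕ.+ r))) ⟩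
            ν 2 * (e n + (1# * (1# * e n) + (ν (n C 1) * P ^ 1 * 0# + (q + t)))) - (ν 4 * e n + ν 2 * q)
              ≡⟨ cong₂ (λ x y → ν 2 * x - (ν 4 * e n + y)) (sym expand) quadratic ⟩
            ν 2 * T n - (ν 4 * e n + P * P * (ν n * (ν n - 1#)) * e (1 ℕ.+ r)) ∎)
          (Int-ν 2 · Div-∑ (suc r) λ k _ → Int-ν (n C (3 ℕ.+ k)) · subst (Div 3)
            (trans (solve 3 (λ p q e → q :* e :* p := p :* q :* e) refl (P ^ 3) (P ^ k) (e (r ∸ k))) (cong (_* e (r ∸ k)) (sym (^-homo-* P 3 k))))
            (Int-* (Int-^ k (Int-ν p)) (Int-e (r ∸ k)) · Div-P^ 3))
          where
          open ≡-Reasoning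
          n = 3 ℕ.+ r
          t = ∑ (suc r) (λ k → ν (n C (3 ℕ.+ k)) * (P ^ (3 ℕ.+ k) * e (r ∸ k)))
          q = ν (n C 2) * (P ^ 2 * e (1 ℕ.+ r))
          e-even : e (2 ℕ.+ r) ≡ 0#
          e-even = trans (cong (λ z → inv (2 ℕ.+ r) * ((1# - ν 2 ^ (3 ℕ.+ r)) * z)) b≡0) (trans (cong (inv (2 ℕ.+ r) *_) (zeroʳ _)) (zeroʳ _))
          expand : T n ≡ e n + (1# * (1# * e n) + (ν (n C 1) * P ^ 1 * 0# + (q + t)))
          expand = trans (T-formula n) (cong (e n +_) (trans (∑-front (3 ℕ.+ r) _) (cong (1# * (1# * e n) +_) (trans (∑-front (2 ℕ.+ r) _)
            (cong₂ _+_ (trans (cong (λ z → ν (n C 1) * (P ^ 1 * z)) e-even) (sym (*-assoc _ _ _))) (∑-front (1 ℕ.+ r) _))))))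
          quadratic : ν 2 * q ≡ P * P * (ν n * (ν n - 1#)) * e (1 ℕ.+ r)
          quadratic = begin
            ν 2 * (ν (n C 2) * (P ^ 2 * e (1 ℕ.+ r)))
              ≡⟨ solve 3 (λ c p e → κ 2 :* (c :* (p :* (p :* κ 1) :* e)) := p :* p :* (κ 2 :* c) :* e) refl (ν (n C 2)) P (e (1 ℕ.+ r)) ⟩
            P * P * (ν 2 * ν (n C 2)) * e (1 ℕ.+ r)
              ≡⟨ cong (λ z → P * P * z * e (1 ℕ.+ r)) (2*C2 (2 ℕ.+ r)) ⟩
            P * P * (ν n * ν (2 ℕ.+ r)) * e (1 ℕ.+ r)
              ≡⟨ cong (λ z → P * P * (ν n * z) * e (1 ℕ.+ r)) (trans (solve 1 (λ x → x := κ 1 :+ x :- κ 1) refl (ν (2 ℕ.+ r))) (cong (_- 1#) (sym (ν-suc (2 ℕ.+ r))))) ⟩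
            P * P * (ν n * (ν n - 1#)) * e (1 ℕ.+ r) ∎

      -- Finite differences of weighted power sums

      νM : ν M ≡ P - 1#
      νM = trans (solve 1 (λ x → x := κ 1 :+ x :- κ 1) refl (ν M)) (cong (_- 1#) (sym (ν-suc M)))

      -- Turns exponents into linear polynomials in p, so that the concluding identities become
      -- polynomial identities for the ring solver.
      ν-affine : ∀ {n} σ j → n ≡ σ ℕ.+ j ℕ.* M → ν n ≡ ν σ + ν j * (P - 1#)
      ν-affine σ j refl = trans (ν-+ σ (j ℕ.* M)) (cong (ν σ +_) (trans (ν-* j M) (cong (ν j *_) νM)))

      -- The index a stands for the base a + 1: a < M runs through the bases 1, ..., p - 1.
      x : ℕ → K
      x a = ν (suc a) ^ M

      Div-x : ∀ {a} → a < M → Div 1 (x a - 1#)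
      Div-x {a} a<M = fermat-unit a (s≤s a<M)

      Int-x : ∀ a → Int (x a)
      Int-x a = Int-^ M (Int-ν (suc a))

      -- The free weight ω covers ordinary and alternating power sums together, so each difference
      -- congruence is proved once for both.
      W : (ℕ → K) → ℕ → K
      W ω j = ∑ M (λ a → ω a * x a ^ j)

      pw : ℕ → ℕ → K
      pw σ a = ν (suc a) ^ σ

      pw± : ℕ → ℕ → K
      pw± σ a = (- 1#) ^ suc a * ν (suc a) ^ σ

      Int-pw : ∀ σ a → Int (pw σ a)
      Int-pw σ a = Int-^ σ (Int-ν (suc a))

      Int-pw± : ∀ σ a → Int (pw± σ a)
      Int-pw± σ a = Int-* (Int-^ (suc a) (Int-neg (Int-ν 1))) (Int-pw σ a)

      pw-x : ∀ {n} σ j a → n ≡ σ ℕ.+ j ℕ.* M → ν (suc a) ^ n ≡ pw σ a * x a ^ j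
      pw-x σ j a refl = trans (^-homo-* (ν (suc a)) σ (j ℕ.* M))
        (cong (pw σ a *_) (trans (cong (ν (suc a) ^_) (ℕP.*-comm j M)) (sym (^-assocʳ (ν (suc a)) M j))))

      -- The exponent is a successor, hence the base 0 contributes nothing and only units remain.
      S-W : ∀ {n} σ j → suc n ≡ σ ℕ.+ j ℕ.* M → S (suc n) ≡ W (pw σ) j
      S-W {n} σ j eq = trans (∑-front M _) (trans (cong (_+ ∑ M (λ a → ν (suc a) ^ suc n)) (zeroˡ _))
        (trans (+-identityˡ _) (∑-cong M λ a _ → pw-x σ j a eq)))

      T-W : ∀ {n} σ j → suc n ≡ σ ℕ.+ j ℕ.* M → altPowerSum p (suc n) ≡ W (pw± σ) j
      T-W {n} σ j eq = trans (∑-front M _) (trans (cong (_+ ∑ M (λ a → (- 1#) ^ suc a * ν (suc a) ^ suc n)) (trans (cong (1# *_) (zeroˡ _)) (zeroʳ 1#)))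
        (trans (+-identityˡ _) (∑-cong M λ a _ → trans (cong ((- 1#) ^ suc a *_) (pw-x σ j a eq)) (sym (*-assoc _ _ _)))))

      ∑-linear : ∀ n c₀ c₁ c₂ c₃ f₀ f₁ f₂ f₃ →
        ∑ n (λ k → c₀ * f₀ k + c₁ * f₁ k + c₂ * f₂ k + c₃ * f₃ k) ≡ c₀ * ∑ n f₀ + c₁ * ∑ n f₁ + c₂ * ∑ n f₂ + c₃ * ∑ n f₃
      ∑-linear n c₀ c₁ c₂ c₃ f₀ f₁ f₂ f₃ = begin
        ∑ n (λ k → c₀ * f₀ k + c₁ * f₁ k + c₂ * f₂ k + c₃ * f₃ k)
          ≡⟨ ∑-+ n _ _ ⟩
        ∑ n (λ k → c₀ * f₀ k + c₁ * f₁ k + c₂ * f₂ k) + ∑ n (λ k → c₃ * f₃ k)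
          ≡⟨ cong (_+ ∑ n (λ k → c₃ * f₃ k)) (trans (∑-+ n _ _) (cong (_+ ∑ n (λ k → c₂ * f₂ k)) (∑-+ n _ _))) ⟩
        ∑ n (λ k → c₀ * f₀ k) + ∑ n (λ k → c₁ * f₁ k) + ∑ n (λ k → c₂ * f₂ k) + ∑ n (λ k → c₃ * f₃ k)
          ≡⟨ cong₂ _+_ (cong₂ _+_ (cong₂ _+_ (∑-* n c₀ f₀) (∑-* n c₁ f₁)) (∑-* n c₂ f₂)) (∑-* n c₃ f₃) ⟩
        c₀ * ∑ n f₀ + c₁ * ∑ n f₁ + c₂ * ∑ n f₂ + c₃ * ∑ n f₃ ∎
        where open ≡-Reasoning

      -- A cubic in x_a that p^e divides at every base becomes, after weighting and summing, the
      -- same relation between four consecutive sums. The differences below are the cases (x - 1)^k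
      -- and (x + 2)(x - 1)².
      W-cubic : ∀ {e} ω c₀ c₁ c₂ c₃ j → (∀ a → Int (ω a)) →
        (∀ a → a < M → Div e (c₀ + c₁ * x a + c₂ * (x a * x a) + c₃ * (x a * (x a * x a)))) →
        Div e (c₀ * W ω j + c₁ * W ω (1 ℕ.+ j) + c₂ * W ω (2 ℕ.+ j) + c₃ * W ω (3 ℕ.+ j))
      W-cubic {e} ω c₀ c₁ c₂ c₃ j iω d = subst (Div e)
        (∑-linear M c₀ c₁ c₂ c₃ (λ a → ω a * x a ^ j) (λ a → ω a * x a ^ (1 ℕ.+ j)) (λ a → ω a * x a ^ (2 ℕ.+ j)) (λ a → ω a * x a ^ (3 ℕ.+ j)))
        (Div-∑ M λ a a<M → subst (Div e)
          (solve 7 (λ w y x c₀ c₁ c₂ c₃ → w :* y :* (c₀ :+ c₁ :* x :+ c₂ :* (x :* x) :+ c₃ :* (x :* (x :* x))) :=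
              c₀ :* (w :* y) :+ c₁ :* (w :* (x :* y)) :+ c₂ :* (w :* (x :* (x :* y))) :+ c₃ :* (w :* (x :* (x :* (x :* y))))) refl
            (ω a) (x a ^ j) (x a) c₀ c₁ c₂ c₃)
          (Int-* (iω a) (Int-^ j (Int-x a)) · d a a<M))

      W-Δ₁ : ∀ ω j → (∀ a → Int (ω a)) → Div 1 (W ω (1 ℕ.+ j) - W ω j)
      W-Δ₁ ω j iω = subst (Div 1)
        (solve 4 (λ a b c d → (:- κ 1) :* a :+ κ 1 :* b :+ κ 0 :* c :+ κ 0 :* d := b :- a) refl _ _ _ _)
        (W-cubic ω (- 1#) 1# 0# 0# j iω λ a a<M → subst (Div 1)
          (solve 1 (λ x → x :- κ 1 := (:- κ 1) :+ κ 1 :* x :+ κ 0 :* (x :* x) :+ κ 0 :* (x :* (x :* x))) refl (x a)) (Div-x a<M))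

      W-Δ₂ : ∀ ω j → (∀ a → Int (ω a)) → Div 2 (W ω (2 ℕ.+ j) - ν 2 * W ω (1 ℕ.+ j) + W ω j)
      W-Δ₂ ω j iω = subst (Div 2)
        (solve 4 (λ a b c d → κ 1 :* a :+ (:- κ 2) :* b :+ κ 1 :* c :+ κ 0 :* d := c :- κ 2 :* b :+ a) refl _ _ _ _)
        (W-cubic ω 1# (- ν 2) 1# 0# j iω λ a a<M → subst (Div 2)
          (solve 1 (λ x → (x :- κ 1) :* (x :- κ 1) := κ 1 :+ (:- κ 2) :* x :+ κ 1 :* (x :* x) :+ κ 0 :* (x :* (x :* x))) refl (x a))
          (Div-* (Div-x a<M) (Div-x a<M)))

      -- From x³ - 3x + 2 = (x + 2)(x - 1)². It relates j + 3 directly to j + 1 and j, as needed for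
      -- eliminating pB_{3(p-1)} in favour of pB_{p-1}.
      W-Δ₂′ : ∀ ω j → (∀ a → Int (ω a)) → Div 2 (W ω (3 ℕ.+ j) - ν 3 * W ω (1 ℕ.+ j) + ν 2 * W ω j)
      W-Δ₂′ ω j iω = subst (Div 2)
        (solve 4 (λ a b c d → κ 2 :* a :+ (:- κ 3) :* b :+ κ 0 :* c :+ κ 1 :* d := d :- κ 3 :* b :+ κ 2 :* a) refl _ _ _ _)
        (W-cubic ω (ν 2) (- ν 3) 0# 1# j iω λ a a<M → subst (Div 2)
          (solve 1 (λ x → (x :+ κ 2) :* ((x :- κ 1) :* (x :- κ 1)) := κ 2 :+ (:- κ 3) :* x :+ κ 0 :* (x :* x) :+ κ 1 :* (x :* (x :* x))) refl (x a))
          (Int-+ (Int-x a) (Int-ν 2) · Div-* (Div-x a<M) (Div-x a<M)))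

      W-Δ₃ : ∀ ω j → (∀ a → Int (ω a)) → Div 3 (W ω (3 ℕ.+ j) - ν 3 * W ω (2 ℕ.+ j) + ν 3 * W ω (1 ℕ.+ j) - W ω j)
      W-Δ₃ ω j iω = subst (Div 3)
        (solve 4 (λ a b c d → (:- κ 1) :* a :+ κ 3 :* b :+ (:- κ 3) :* c :+ κ 1 :* d := d :- κ 3 :* c :+ κ 3 :* b :- a) refl _ _ _ _)
        (W-cubic ω (- 1#) (ν 3) (- ν 3) 1# j iω λ a a<M → subst (Div 3)
          (solve 1 (λ x → (x :- κ 1) :* ((x :- κ 1) :* (x :- κ 1)) := (:- κ 1) :+ κ 3 :* x :+ (:- κ 3) :* (x :* x) :+ κ 1 :* (x :* (x :* x))) refl (x a))
          (Div-* (Div-x a<M) (Div-* (Div-x a<M) (Div-x a<M))))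

      -- With y = 1/x one has y − 4 + 6x − 4x² + x³ = y (x − 1)⁴.
      W-inverse : ∀ ω → (∀ a → Int (ω a)) →
        Div 4 (∑ M (λ a → ω a * inv a ^ M) - (ν 4 * W ω 0 - ν 6 * W ω 1 + ν 4 * W ω 2 - W ω 3))
      W-inverse ω iω = subst (Div 4) (begin
          ∑ M (λ a → f a + g a)
            ≡⟨ ∑-+ M f g ⟩
          ∑ M f + ∑ M g
            ≡⟨ cong (∑ M f +_) (∑-linear M (- ν 4) (ν 6) (- ν 4) 1# (λ a → ω a * x a ^ 0) (λ a → ω a * x a ^ 1) (λ a → ω a * x a ^ 2) (λ a → ω a * x a ^ 3)) ⟩
          ∑ M f + (- ν 4 * W ω 0 + ν 6 * W ω 1 + - ν 4 * W ω 2 + 1# * W ω 3)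
            ≡⟨ solve 5 (λ h a b c d → h :+ ((:- κ 4) :* a :+ κ 6 :* b :+ (:- κ 4) :* c :+ κ 1 :* d) := h :- (κ 4 :* a :- κ 6 :* b :+ κ 4 :* c :- d)) refl
                 (∑ M f) (W ω 0) (W ω 1) (W ω 2) (W ω 3) ⟩
          ∑ M f - (ν 4 * W ω 0 - ν 6 * W ω 1 + ν 4 * W ω 2 - W ω 3) ∎)
        (Div-∑ M λ a a<M → subst (Div 4) (begin
            ω a * inv a ^ M * ((x a - 1#) * ((x a - 1#) * ((x a - 1#) * (x a - 1#))))
              ≡⟨ solve 3 (λ w y x → w :* y :* ((x :- κ 1) :* ((x :- κ 1) :* ((x :- κ 1) :* (x :- κ 1)))) :=
                   w :* y :+ ((:- κ 4) :* (w :* (x :* y)) :+ κ 6 :* (w :* (x :* (x :* y))) :+ (:- κ 4) :* (w :* (x :* (x :* (x :* y)))) :+ κ 1 :* (w :* (x :* (x :* (x :* (x :* y)))))))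
                   refl (ω a) (inv a ^ M) (x a) ⟩
            h a (x a * inv a ^ M)
              -- Apart from the leading w·y, every term contains the product x·y = 1; it turns into
              -- the final factor 1 of the powers `x a ^ j`.
              ≡⟨ cong (h a) (trans (sym (*-^ (ν (suc a)) (inv a) M)) (trans (cong (_^ M) (inv-inverse a)) (1^ M))) ⟩
            h a 1# ∎)
          (Int-* (iω a) (Int-^ M (Int-inv (p∤small (s≤s a<M)))) · Div-* (Div-x a<M) (Div-* (Div-x a<M) (Div-* (Div-x a<M) (Div-x a<M)))))
        where
        open ≡-Reasoning
        f g : ℕ → K
        f a = ω a * inv a ^ M
        g a = - ν 4 * (ω a * x a ^ 0) + ν 6 * (ω a * x a ^ 1) + - ν 4 * (ω a * x a ^ 2) + 1# * (ω a * x a ^ 3)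
        h : ℕ → K → K
        h a z = f a + (- ν 4 * (ω a * z) + ν 6 * (ω a * (x a * z)) + - ν 4 * (ω a * (x a * (x a * z))) + 1# * (ω a * (x a * (x a * (x a * z)))))

      -- p is odd; even indices are kept in the form 4 + 2 (s + 1) so that subtracting 2 computes.
      module EvenIndices (t : ℕ) (M≡ : 4 ℕ.+ 2 ℕ.* suc t ≡ M) where

        b₃-odd : ∀ s → b (3 ℕ.+ 2 ℕ.* suc s) ≡ 0#
        b₃-odd s = trans (cong (λ n → b (suc n)) (sym (ℕP.*-suc 2 (suc s)))) (b-odd (suc s))

        b₅-odd : ∀ s → b (5 ℕ.+ 2 ℕ.* suc s) ≡ 0#
        b₅-odd s = trans (cong (λ n → b (3 ℕ.+ n)) (sym (ℕP.*-suc 2 (suc s)))) (b₃-odd (suc s))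

        M≡2h : M ≡ 2 ℕ.* (3 ℕ.+ t)
        M≡2h = trans (sym M≡) (sym (trans (ℕP.*-suc 2 (2 ℕ.+ t)) (cong (2 ℕ.+_) (ℕP.*-suc 2 (suc t)))))

        W-mod-p⁴ : ∀ {n} s σ j → 4 ℕ.+ 2 ℕ.* suc s ≡ n → n ≡ σ ℕ.+ j ℕ.* M → let N = ν σ + ν j * (P - 1#) in
          Div 4 (ν 6 * W (pw σ) j - (ν 6 * (P * b n) + P * P * (N * (N - 1#)) * (P * b (n ∸ 2))))
        W-mod-p⁴ s σ j refl eq = subst (Div 4)
          (cong₂ (λ w N → ν 6 * w - (ν 6 * (P * b (4 ℕ.+ r)) + P * P * (N * (N - 1#)) * (P * b (2 ℕ.+ r)))) (S-W σ j eq) (ν-affine σ j eq))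
          (S-mod-p⁴ r (b-odd s) (b₃-odd s))
          where r = 2 ℕ.* suc s

        W-mod-p² : ∀ {n} s σ j → 2 ℕ.+ 2 ℕ.* suc s ≡ n → n ≡ σ ℕ.+ j ℕ.* M → Div 2 (W (pw σ) j - P * b n)
        W-mod-p² s σ j refl eq = subst (λ w → Div 2 (w - P * b (2 ℕ.+ 2 ℕ.* suc s))) (S-W σ j eq) (S≡Pb-mod-p² (2 ℕ.* suc s) (b-odd s))

        W± : ℕ → K
        W± = W (pw± 1)

        W±-mod-p³ : ∀ {n} s j → 5 ℕ.+ 2 ℕ.* suc s ≡ n → n ≡ 1 ℕ.+ j ℕ.* M → let N = ν 1 + ν j * (P - 1#) in
          Div 3 (ν 2 * W± j - (ν 4 * e n + P * P * (N * (N - 1#)) * e (n ∸ 2)))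
        W±-mod-p³ s j refl eq = subst (Div 3)
          (cong₂ (λ w N → ν 2 * w - (ν 4 * e (5 ℕ.+ r) + P * P * (N * (N - 1#)) * e (3 ℕ.+ r))) (T-W 1 j eq) (ν-affine 1 j eq))
          (T-mod-p³ (3 ℕ.+ t) M≡2h (2 ℕ.+ r) (b₅-odd s))
          where r = 2 ℕ.* suc s

        open +-*-Solver using () renaming (solve to solveⁿ; _:=_ to _:=ⁿ_; _:+_ to _:+ⁿ_; _:*_ to _:*ⁿ_; con to conⁿ; Polynomial to Polynomialⁿ)

        even : ∀ {n} → Polynomialⁿ n → Polynomialⁿ n
        even s = conⁿ 4 :+ⁿ conⁿ 2 :*ⁿ (conⁿ 1 :+ⁿ s)

        -- Since M = 6 + 2t, the parameters s belonging to 2M and 3M are 3 + 2t and 6 + 3t; these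
        -- are the values passed to the index lemmas below.
        2M : 4 ℕ.+ 2 ℕ.* suc (3 ℕ.+ 2 ℕ.* t) ≡ 2 ℕ.* M
        2M = trans (solveⁿ 1 (λ t → even (conⁿ 3 :+ⁿ conⁿ 2 :*ⁿ t) :=ⁿ conⁿ 2 :*ⁿ even t) refl t) (cong (2 ℕ.*_) M≡)

        3M : 4 ℕ.+ 2 ℕ.* suc (6 ℕ.+ 3 ℕ.* t) ≡ 3 ℕ.* M
        3M = trans (solveⁿ 1 (λ t → even (conⁿ 6 :+ⁿ conⁿ 3 :*ⁿ t) :=ⁿ conⁿ 3 :*ⁿ even t) refl t) (cong (3 ℕ.*_) M≡)

        W0 : W (pw 0) 0 ≡ P - 1#
        W0 = trans (∑-const M (1# * 1#)) (trans (cong (_* (1# * 1#)) νM) (solve 1 (λ p → (p :- κ 1) :* (κ 1 :* κ 1) := p :- κ 1) refl P))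

        Int-pw0 : ∀ a → Int (pw 0 a)
        Int-pw0 = Int-pw 0

        -- All x_a^j are ≡ 1, so the power sum is ≡ p - 1, the number of bases, and modulo p it
        -- equals pB_n.
        Pb+1 : ∀ {n} s j → 4 ℕ.+ 2 ℕ.* suc s ≡ n → n ≡ 0 ℕ.+ j ℕ.* M → Div 1 (P * b n + 1#)
        Pb+1 {n} s j eq eq′ = subst (Div 1)
          (trans (cong (λ z → W (pw 0) j - z + P - (W (pw 0) j - P * b n)) W0)
            (solve 3 (λ w p y → w :- (p :- κ 1) :+ p :- (w :- y) := y :+ κ 1) refl (W (pw 0) j) P (P * b n)))
          (Div-+ (W-constant j) Div-P ⊖ residue eq)
          where
          W-constant : ∀ j → Div 1 (W (pw 0) j - W (pw 0) 0)
          W-constant zero    = subst (Div 1) (solve 1 (λ x → κ 0 := x :- x) refl _) Div-0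
          W-constant (suc j) = subst (Div 1) (solve 3 (λ x y z → x :- y :+ (y :- z) := x :- z) refl _ _ _)
            (Div-+ (W-Δ₁ (pw 0) j Int-pw0) (W-constant j))
          residue : 4 ℕ.+ 2 ℕ.* suc s ≡ n → Div 1 (W (pw 0) j - P * b n)
          residue refl = subst (λ w → Div 1 (w - P * b (4 ℕ.+ 2 ℕ.* suc s))) (S-W 0 j eq′) (S≡Pb-mod-p (3 ℕ.+ 2 ℕ.* suc s))

        N₀ : ℕ → K
        N₀ j = ν 0 + ν j * (P - 1#)

        -- The congruence for H_{p-1,p-1}

        module Part₂ where
          σ : ℕ
          σ = 2 ℕ.+ 2 ℕ.* suc t

          c₁ c₂ c₃ d₁ d₂ d₃ : K
          c₁ = P * b M
          c₂ = P * b (2 ℕ.* M)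
          c₃ = P * b (3 ℕ.* M)
          d₁ = P * b (M ∸ 2)
          d₂ = P * b (2 ℕ.* M ∸ 2)
          d₃ = P * b (3 ℕ.* M ∸ 2)

          M-2 : M ∸ 2 ≡ σ
          M-2 = cong (_∸ 2) (sym M≡)

          s₁ s₂ s₃ : K
          s₁ = W (pw σ) 0
          s₂ = W (pw σ) 1
          s₃ = W (pw σ) 2

          δ₁ : Div 2 (s₁ - d₁)
          δ₁ = W-mod-p² t σ 0 (cong (_∸ 2) M≡) (trans M-2 (sym (ℕP.+-identityʳ σ)))

          δ₂ : Div 2 (s₂ - d₂)
          δ₂ = W-mod-p² (3 ℕ.+ 2 ℕ.* t) σ 1 (cong (_∸ 2) 2M) (trans (cong (_∸ 2) (sym 2M))
            (trans (solveⁿ 1 (λ t → conⁿ 2 :+ⁿ conⁿ 2 :*ⁿ (conⁿ 4 :+ⁿ conⁿ 2 :*ⁿ t) :=ⁿ conⁿ 2 :+ⁿ conⁿ 2 :*ⁿ (conⁿ 1 :+ⁿ t) :+ⁿ conⁿ 1 :*ⁿ even t) refl t)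
              (cong (λ m → σ ℕ.+ 1 ℕ.* m) M≡)))

          δ₃ : Div 2 (s₃ - d₃)
          δ₃ = W-mod-p² (6 ℕ.+ 3 ℕ.* t) σ 2 (cong (_∸ 2) 3M) (trans (cong (_∸ 2) (sym 3M))
            (trans (solveⁿ 1 (λ t → conⁿ 2 :+ⁿ conⁿ 2 :*ⁿ (conⁿ 7 :+ⁿ conⁿ 3 :*ⁿ t) :=ⁿ conⁿ 2 :+ⁿ conⁿ 2 :*ⁿ (conⁿ 1 :+ⁿ t) :+ⁿ conⁿ 2 :*ⁿ even t) refl t)
              (cong (λ m → σ ℕ.+ 2 ℕ.* m) M≡)))

          Div-s₁ : Div 1 s₁
          Div-s₁ = subst (Div 1) (S-W σ 0 (sym (ℕP.+-identityʳ σ)))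
            (Div-S (1 ℕ.+ 2 ℕ.* suc t) (subst (3 ℕ.+ 2 ℕ.* suc t <_) (cong suc M≡) (ℕP.n≤1+n _)))

          Div-s₂ : Div 1 s₂
          Div-s₂ = subst (Div 1) (solve 2 (λ x y → y :- x :+ x := y) refl s₁ s₂) (Div-+ (W-Δ₁ (pw σ) 0 (Int-pw σ)) Div-s₁)

          Int-N₀ : ∀ j → Int (N₀ j)
          Int-N₀ j = Int-+ (Int-ν 0) (Int-* (Int-ν j) (Int-+ Int-P (Int-neg (Int-ν 1))))

          Int-NN : ∀ j → Int (N₀ j * (N₀ j - 1#))
          Int-NN j = Int-* (Int-N₀ j) (Int-+ (Int-N₀ j) (Int-neg (Int-ν 1)))

          g₁ g₂ g₃ : K
          g₁ = N₀ 1 * (N₀ 1 - 1#) * d₁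
          g₂ = N₀ 2 * (N₀ 2 - 1#) * d₂
          g₃ = N₀ 3 * (N₀ 3 - 1#) * d₃

          -- Modulo p the factors N(N - 1) are j(j + 1) = 2, 6, 12, so the combination is -12 times
          -- a second difference of power sums, which p² divides. The errors made in these factors
          -- are multiples of p and meet power sums that are themselves divisible by p.
          cancellation : Div 2 (ν 4 * g₂ - ν 6 * g₁ - g₃)
          cancellation = subst (Div 2)
            (solve 7 (λ p s₁ s₂ s₃ d₁ d₂ d₃ →
                let m = p :- κ 1 ; n₁ = κ 0 :+ κ 1 :* m ; n₂ = κ 0 :+ κ 2 :* m ; n₃ = κ 0 :+ κ 3 :* m in
                κ 6 :* (n₁ :* (n₁ :- κ 1) :* (s₁ :- d₁)) :- κ 4 :* (n₂ :* (n₂ :- κ 1) :* (s₂ :- d₂)) :+ n₃ :* (n₃ :- κ 1) :* (s₃ :- d₃)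
                  :- n₃ :* (n₃ :- κ 1) :* (s₃ :- κ 2 :* s₂ :+ s₁) :+ m :* (p :* (κ 3 :* s₁ :- κ 2 :* s₂)) :=
                κ 4 :* (n₂ :* (n₂ :- κ 1) :* d₂) :- κ 6 :* (n₁ :* (n₁ :- κ 1) :* d₁) :- n₃ :* (n₃ :- κ 1) :* d₃) refl
              P s₁ s₂ s₃ d₁ d₂ d₃)
            (Div-+ (Div-+ (Int-ν 6 · Int-NN 1 · δ₁ ⊖ Int-ν 4 · Int-NN 2 · δ₂) (Int-NN 3 · δ₃)
                ⊖ Int-NN 3 · W-Δ₂ (pw σ) 0 (Int-pw σ))
              (Int-+ Int-P (Int-neg (Int-ν 1)) · Div-* Div-P (Int-ν 3 · Div-s₁ ⊖ Int-ν 2 · Div-s₂)))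

          w₁ w₂ w₃ : K
          w₁ = W (pw 0) 1
          w₂ = W (pw 0) 2
          w₃ = W (pw 0) 3

          ε₁ : Div 4 (ν 6 * w₁ - (ν 6 * c₁ + P * P * (N₀ 1 * (N₀ 1 - 1#)) * d₁))
          ε₁ = W-mod-p⁴ t 0 1 M≡ (sym (ℕP.*-identityˡ M))

          ε₂ : Div 4 (ν 6 * w₂ - (ν 6 * c₂ + P * P * (N₀ 2 * (N₀ 2 - 1#)) * d₂))
          ε₂ = W-mod-p⁴ (3 ℕ.+ 2 ℕ.* t) 0 2 2M refl

          ε₃ : Div 4 (ν 6 * w₃ - (ν 6 * c₃ + P * P * (N₀ 3 * (N₀ 3 - 1#)) * d₃))
          ε₃ = W-mod-p⁴ (6 ℕ.+ 3 ℕ.* t) 0 3 3M refl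

          H : K
          H = ∑ M (λ a → inv a ^ M)

          H-reduced : Div 4 (H - (ν 4 * (P - 1#) - ν 6 * w₁ + ν 4 * w₂ - w₃))
          H-reduced = subst (Div 4) (cong₂ (λ h w → h - (ν 4 * w - ν 6 * w₁ + ν 4 * w₂ - w₃))
            (∑-cong M λ a _ → *-identityˡ (inv a ^ M)) W0) (W-inverse (pw 0) Int-pw0)

          -- Since `inv n` is 1/(n+1), the constants `inv 2`, `inv 1`, `inv 5` are 1/3, 1/2, 1/6.
          rhs : K
          rhs = (ν 13 * (P * P * P) + ν 12 * P - ν 12) * inv 2
            + (ν 19 * (P * P * P) - ν 12) * inv 1 * c₁
            + (ν 4 - ν 7 * (P * P * P)) * c₂
            + (ν 11 * (P * P * P) - ν 6) * inv 5 * c₃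

          6*rhs : ν 6 * rhs ≡ ν 2 * (ν 13 * (P * P * P) + ν 12 * P - ν 12) + ν 3 * (ν 19 * (P * P * P) - ν 12) * c₁
            + ν 6 * (ν 4 - ν 7 * (P * P * P)) * c₂ + (ν 11 * (P * P * P) - ν 6) * c₃
          6*rhs = trans (solve 10 (λ x y z w i₂ i₁ i₅ c₁ c₂ c₃ →
              κ 6 :* (x :* i₂ :+ y :* i₁ :* c₁ :+ z :* c₂ :+ w :* i₅ :* c₃) :=
              κ 3 :* i₂ :* (κ 2 :* x) :+ κ 2 :* i₁ :* (κ 3 :* y :* c₁) :+ κ 6 :* z :* c₂ :+ κ 6 :* i₅ :* (w :* c₃)) refl
              k₁ k₂ k₃ k₄ (inv 2) (inv 1) (inv 5) c₁ c₂ c₃)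
            (trans (cong₂ _+_ (cong (_+ ν 6 * k₃ * c₂) (cong₂ _+_ (drop 2) (drop 1))) (drop 5)) refl)
            where
            k₁ k₂ k₃ k₄ : K
            k₁ = ν 13 * (P * P * P) + ν 12 * P - ν 12
            k₂ = ν 19 * (P * P * P) - ν 12
            k₃ = ν 4 - ν 7 * (P * P * P)
            k₄ = ν 11 * (P * P * P) - ν 6
            drop : ∀ n {v} → ν (suc n) * inv n * v ≡ v
            drop n {v} = trans (cong (_* v) (inv-inverse n)) (*-identityˡ v)

          result : Div 4 (H - rhs)
          result = Div-unit p∤6 (subst (Div 4)
            (trans (solve 11 (λ p h w₁ w₂ w₃ c₁ c₂ c₃ d₁ d₂ d₃ →
                let m = p :- κ 1 ; n₁ = κ 0 :+ κ 1 :* m ; n₂ = κ 0 :+ κ 2 :* m ; n₃ = κ 0 :+ κ 3 :* m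
                    n₁ = n₁ :* (n₁ :- κ 1) ; n₂ = n₂ :* (n₂ :- κ 1) ; n₃ = n₃ :* (n₃ :- κ 1) in
                κ 6 :* (h :- (κ 4 :* m :- κ 6 :* w₁ :+ κ 4 :* w₂ :- w₃))
                  :- κ 6 :* (κ 6 :* w₁ :- (κ 6 :* c₁ :+ p :* p :* n₁ :* d₁))
                  :+ κ 4 :* (κ 6 :* w₂ :- (κ 6 :* c₂ :+ p :* p :* n₂ :* d₂))
                  :- (κ 6 :* w₃ :- (κ 6 :* c₃ :+ p :* p :* n₃ :* d₃))
                  :+ p :* (p :* (κ 4 :* (n₂ :* d₂) :- κ 6 :* (n₁ :* d₁) :- n₃ :* d₃))
                  -- The p³-terms of 6·`rhs` are 26 + 57c₁ - 42c₂ + 11c₃. Because 26 = 57 - 42 + 11,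
                  -- they regroup into multiples of the c_j + 1, each divisible by p.
                  :- p :* (p :* (p :* (κ 57 :* (c₁ :+ κ 1) :- κ 42 :* (c₂ :+ κ 1) :+ κ 11 :* (c₃ :+ κ 1)))) :=
                κ 6 :* h :- (κ 2 :* (κ 13 :* (p :* p :* p) :+ κ 12 :* p :- κ 12) :+ κ 3 :* (κ 19 :* (p :* p :* p) :- κ 12) :* c₁
                  :+ κ 6 :* (κ 4 :- κ 7 :* (p :* p :* p)) :* c₂ :+ (κ 11 :* (p :* p :* p) :- κ 6) :* c₃)) refl
                P H w₁ w₂ w₃ c₁ c₂ c₃ d₁ d₂ d₃)
              (trans (cong (λ z → ν 6 * H - z) (sym 6*rhs)) (solve 2 (λ h r → κ 6 :* h :- κ 6 :* r := κ 6 :* (h :- r)) refl H rhs)))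
            (Div-+ (Div-+ (Int-ν 6 · H-reduced ⊖ Int-ν 6 · ε₁) (Int-ν 4 · ε₂) ⊖ ε₃)
                (Div-* Div-P (Div-* Div-P cancellation))
              ⊖ Div-* Div-P (Div-* Div-P (Div-* Div-P
                  (Div-+ (Int-ν 57 · Pb+1 t 1 M≡ (sym (ℕP.*-identityˡ M)) ⊖ Int-ν 42 · Pb+1 (3 ℕ.+ 2 ℕ.* t) 2 2M refl)
                    (Int-ν 11 · Pb+1 (6 ℕ.+ 3 ℕ.* t) 3 3M refl))))))

        -- Kummer's congruence of third order

        β : ℕ → K
        β n = b (suc n) * inv n

        b-β : ∀ n → b (suc n) ≡ ν (suc n) * β n
        b-β n = sym (begin
          ν (suc n) * (b (suc n) * inv n)  ≡⟨ solve 3 (λ n b i → n :* (b :* i) := n :* i :* b) refl (ν (suc n)) (b (suc n)) (inv n) ⟩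
          ν (suc n) * inv n * b (suc n)    ≡⟨ cong (_* b (suc n)) (inv-inverse n) ⟩
          1# * b (suc n)                   ≡⟨ *-identityˡ _ ⟩
          b (suc n)                        ∎)
          where open ≡-Reasoning

        u : K
        u = ν 2 ^ M

        Div-u : Div 1 (u - 1#)
        Div-u = fermat-unit 1 (<p (s≤s z≤n))

        Int-u : Int u
        Int-u = Int-^ M (Int-ν 2)

        Div-u^ : ∀ j → Div 1 (u ^ j - 1#)
        Div-u^ zero    = subst (Div 1) (solve 0 (κ 0 := κ 1 :- κ 1) refl) Div-0
        Div-u^ (suc j) = subst (Div 1) (solve 2 (λ u v → u :* (v :- κ 1) :+ (u :- κ 1) := u :* v :- κ 1) refl u (u ^ j))
          (Div-+ (Int-u · Div-u^ j) Div-u)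

        e-β : ∀ {n} j → n ≡ 1 ℕ.+ j ℕ.* M → e n ≡ (1# - ν 4 * u ^ j) * β n
        e-β {n} j eq = trans (cong (λ z → inv n * ((1# - z) * b (suc n))) power)
          (solve 3 (λ i v b → i :* ((κ 1 :- κ 4 :* v) :* b) := (κ 1 :- κ 4 :* v) :* (b :* i)) refl (inv n) (u ^ j) (b (suc n)))
          where
          power : ν 2 ^ suc n ≡ ν 4 * u ^ j
          power = trans (pw-x {suc n} 2 j 1 (cong suc eq)) (cong (_* u ^ j) (solve 0 (κ 2 :* (κ 2 :* κ 1) := κ 4) refl))

        -- As 2^{n+1} = 4u^j with u ≡ 1, the factor 4u^j - 1 between -`e` and `β` is 3 plus a
        -- multiple of p, and p is not 3.
        Int-β : ∀ {n} j → n ≡ 1 ℕ.+ j ℕ.* M → Int (β n)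
        Int-β {n} j eq = Int-descent {ν 4 * (u ^ j - 1#)} (suc n) p∤3 (Int-ν 4 · Div-u^ j)
          (subst Int (trans (cong -_ (e-β j eq))
            (solve 2 (λ v z → :- ((κ 1 :- κ 4 :* v) :* z) := (κ 3 :+ κ 4 :* (v :- κ 1)) :* z) refl (u ^ j) (β n))) (Int-neg (Int-e n)))
          -- The descent starts at p^{n+1}: one factor p makes the Bernoulli number integral, the
          -- other n take care of 1/(n+1).
          (subst Int (solve 4 (λ p q b i → p :* b :* (q :* i) := p :* q :* (b :* i)) refl P (P ^ n) (b (suc n)) (inv n))
            (Int-* (Int-Pb (suc n)) (Int-P^*inv n (p^-growth 0 n (<p z≤n)))))

        -- The member j = 0, with exponent 1, is known exactly. It is the source of the constant (1
        -- - p)/12.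
        W±-zero : ν 2 * W± 0 ≡ P - 1#
        W±-zero = begin
          ν 2 * W± 0
            ≡⟨ cong (ν 2 *_) (T-W {0} 1 0 refl) ⟨
          ν 2 * altPowerSum p 1
            ≡⟨ cong (ν 2 *_) (T-formula (3 ℕ.+ t) (M≡2h) 1) ⟩
          ν 2 * (e 1 + (0# + 1# * (1# * e 1) + 1# * (P * 1# * e 0)))
            ≡⟨ solve 5 (λ p i₀ i₁ b₁ b₂ →
                 let e₁ = i₁ :* ((κ 1 :- κ 2 :* (κ 2 :* κ 1)) :* b₂) ; e₀ = i₀ :* ((κ 1 :- κ 2 :* κ 1) :* b₁) in
                 κ 2 :* (e₁ :+ (κ 0 :+ κ 1 :* (κ 1 :* e₁) :+ κ 1 :* (p :* κ 1 :* e₀))) :=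
                 κ 2 :* i₁ :* ((:- κ 6) :* b₂) :+ κ 1 :* i₀ :* ((:- κ 2) :* p :* b₁)) refl P (inv 0) (inv 1) (b 1) (b 2) ⟩
          ν 2 * inv 1 * (- ν 6 * b 2) + ν 1 * inv 0 * (- ν 2 * P * b 1)
            ≡⟨ cong₂ (λ x y → x * (- ν 6 * b 2) + y * (- ν 2 * P * b 1)) (inv-inverse 1) (inv-inverse 0) ⟩
          1# * (- ν 6 * b 2) + 1# * (- ν 2 * P * b 1)
            -- The multipliers 3 - p and -2 eliminate B_1 and B_2 by means of 1 + 2B_1 = 0 and 1 +
            -- 3B_1 + 3B_2 = 0.
            ≡⟨ solve 3 (λ p b₁ b₂ →
                 κ 1 :* ((:- κ 6) :* b₂) :+ κ 1 :* ((:- κ 2) :* p :* b₁) :=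
                 p :- κ 1 :+ (κ 3 :- p) :* (κ 1 :* κ 1 :+ (κ 0 :+ κ 2 :* b₁)) :- κ 2 :* (κ 1 :* κ 1 :+ (κ 0 :+ κ 3 :* b₁ :+ κ 3 :* b₂))) refl P (b 1) (b 2) ⟩
          P - 1# + (ν 3 - P) * (1# * 1# + (0# + ν 2 * b 1)) - ν 2 * (1# * 1# + (0# + ν 3 * b 1 + ν 3 * b 2))
            ≡⟨ cong₂ (λ x y → P - 1# + (ν 3 - P) * x - ν 2 * y) (rec 0) (rec 1) ⟩
          P - 1# + (ν 3 - P) * 0# - ν 2 * 0#
            ≡⟨ solve 1 (λ p → p :- κ 1 :+ (κ 3 :- p) :* κ 0 :- κ 2 :* κ 0 := p :- κ 1) refl P ⟩
          P - 1# ∎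
          where
          open ≡-Reasoning
          rec : ∀ n → 1# * 1# + ∑ (suc n) (λ k → ν (suc (suc n) C suc k) * b (suc k)) ≡ 0#
          rec n = trans (sym (trans (∑-front (suc n) _) (cong (λ z → 1# * z + ∑ (suc n) (λ k → ν (suc (suc n) C suc k) * b (suc k))) b-zero))) (b-rec n)

        N₁ : ℕ → K
        N₁ j = ν 1 + ν j * (P - 1#)

        n₁ n₂ n₃ : ℕ
        n₁ = suc M
        n₂ = suc (2 ℕ.* M)
        n₃ = suc (3 ℕ.* M)

        n₁-eq : n₁ ≡ 1 ℕ.+ 1 ℕ.* M
        n₁-eq = cong suc (sym (ℕP.*-identityˡ M))

        -- With the index shift in `β` these are B_{p+1}/(p+1), B_{2p}/(2p) and B_{3p-1}/(3p-1).
        β₁ β₂ β₃ : K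
        β₁ = β n₁
        β₂ = β n₂
        β₃ = β n₃

        iβ₁ : Int β₁
        iβ₁ = Int-β 1 n₁-eq
        iβ₂ : Int β₂
        iβ₂ = Int-β 2 refl
        iβ₃ : Int β₃
        iβ₃ = Int-β 3 refl

        module Kummer where
          e₁ e₂ e₃ ε₁ ε₂ ε₃ τ₀ τ₁ τ₂ τ₃ w : K
          e₁ = (1# - ν 4 * u ^ 1) * β₁
          e₂ = (1# - ν 4 * u ^ 2) * β₂
          e₃ = (1# - ν 4 * u ^ 3) * β₃
          ε₁ = e (n₁ ∸ 2)
          ε₂ = e (n₂ ∸ 2)
          ε₃ = e (n₃ ∸ 2)
          τ₀ = W± 0
          τ₁ = W± 1
          τ₂ = W± 2
          τ₃ = W± 3
          w  = u - 1#

          Int-w : Int w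
          Int-w = Int-+ Int-u (Int-neg (Int-ν 1))

          F₁ : Div 3 (ν 2 * τ₁ - (ν 4 * e₁ + P * P * (N₁ 1 * (N₁ 1 - 1#)) * ε₁))
          F₁ = subst (λ z → Div 3 (ν 2 * τ₁ - (ν 4 * z + P * P * (N₁ 1 * (N₁ 1 - 1#)) * ε₁))) (e-β 1 n₁-eq)
            (W±-mod-p³ t 1 (cong suc M≡) n₁-eq)

          F₂ : Div 3 (ν 2 * τ₂ - (ν 4 * e₂ + P * P * (N₁ 2 * (N₁ 2 - 1#)) * ε₂))
          F₂ = subst (λ z → Div 3 (ν 2 * τ₂ - (ν 4 * z + P * P * (N₁ 2 * (N₁ 2 - 1#)) * ε₂))) (e-β 2 refl)
            (W±-mod-p³ (3 ℕ.+ 2 ℕ.* t) 2 (cong suc 2M) refl)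

          F₃ : Div 3 (ν 2 * τ₃ - (ν 4 * e₃ + P * P * (N₁ 3 * (N₁ 3 - 1#)) * ε₃))
          F₃ = subst (λ z → Div 3 (ν 2 * τ₃ - (ν 4 * z + P * P * (N₁ 3 * (N₁ 3 - 1#)) * ε₃))) (e-β 3 refl)
            (W±-mod-p³ (6 ℕ.+ 3 ℕ.* t) 3 (cong suc 3M) refl)

          ±Int : ∀ σ a → Int (pw± σ a)
          ±Int = Int-pw±

          σ : ℕ
          σ = 3 ℕ.+ 2 ℕ.* suc t

          ε-mod-p : ∀ {n} s j → 3 ℕ.+ 2 ℕ.* suc s ≡ n → n ≡ σ ℕ.+ j ℕ.* M → Div 1 (W (pw± σ) j - ν 2 * e n)
          ε-mod-p s j refl eq = subst (λ z → Div 1 (z - ν 2 * e (3 ℕ.+ 2 ℕ.* suc s))) (T-W σ j eq)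
            (T-mod-p (3 ℕ.+ t) (M≡2h) (3 ℕ.+ 2 ℕ.* suc s))

          -- Modulo p both are half of an alternating power sum, and the two exponents differ by p -
          -- 1.
          ε₃-ε₂ : Div 1 (ε₃ - ε₂)
          ε₃-ε₂ = Div-unit p∤2 (subst (Div 1)
            (solve 4 (λ x y a b → (y :- x) :- (y :- κ 2 :* b) :+ (x :- κ 2 :* a) := κ 2 :* (b :- a)) refl
              (W (pw± σ) 1) (W (pw± σ) 2) ε₂ ε₃)
            (Div-+ (W-Δ₁ (pw± σ) 1 (±Int σ)
              ⊖ ε-mod-p (6 ℕ.+ 3 ℕ.* t) 2 (cong (_∸ 1) 3M) (trans (cong (_∸ 1) (sym 3M))
                  (trans (solveⁿ 1 (λ t → conⁿ 3 :+ⁿ conⁿ 2 :*ⁿ (conⁿ 7 :+ⁿ conⁿ 3 :*ⁿ t) :=ⁿ conⁿ 3 :+ⁿ conⁿ 2 :*ⁿ (conⁿ 1 :+ⁿ t) :+ⁿ conⁿ 2 :*ⁿ even t) refl t)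
                    (cong (λ m → σ ℕ.+ 2 ℕ.* m) M≡))))
              (ε-mod-p (3 ℕ.+ 2 ℕ.* t) 1 (cong (_∸ 1) 2M) (trans (cong (_∸ 1) (sym 2M))
                  (trans (solveⁿ 1 (λ t → conⁿ 3 :+ⁿ conⁿ 2 :*ⁿ (conⁿ 4 :+ⁿ conⁿ 2 :*ⁿ t) :=ⁿ conⁿ 3 :+ⁿ conⁿ 2 :*ⁿ (conⁿ 1 :+ⁿ t) :+ⁿ conⁿ 1 :*ⁿ even t) refl t)
                    (cong (λ m → σ ℕ.+ 1 ℕ.* m) M≡))))))

          Int-N₁ : ∀ j → Int (N₁ j)
          Int-N₁ j = Int-+ (Int-ν 1) (Int-* (Int-ν j) (Int-+ Int-P (Int-neg (Int-ν 1))))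

          Int-G : ∀ j n → Int (N₁ j * (N₁ j - 1#) * e n)
          Int-G j n = Int-* (Int-* (Int-N₁ j) (Int-+ (Int-N₁ j) (Int-neg (Int-ν 1)))) (Int-e n)

          G₁ G₂ G₃ : K
          G₁ = N₁ 1 * (N₁ 1 - 1#) * ε₁
          G₂ = N₁ 2 * (N₁ 2 - 1#) * ε₂
          G₃ = N₁ 3 * (N₁ 3 - 1#) * ε₃

          iG₁ : Int G₁
          iG₁ = Int-G 1 _
          iG₂ : Int G₂
          iG₂ = Int-G 2 _
          iG₃ : Int G₃
          iG₃ = Int-G 3 _

          Δe₂ : Div 1 (ν 4 * (e₂ - e₁))
          Δe₂ = subst (Div 1)
            (solve 9 (λ p x y e f a b c d →
                κ 2 :* (y :- x) :- (κ 2 :* y :- (κ 4 :* f :+ p :* p :* a :* b)) :+ (κ 2 :* x :- (κ 4 :* e :+ p :* p :* c :* d)) :- p :* (p :* (a :* b :- c :* d)) :=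
                κ 4 :* (f :- e)) refl P τ₁ τ₂ e₁ e₂ (N₁ 2 * (N₁ 2 - 1#)) ε₂ (N₁ 1 * (N₁ 1 - 1#)) ε₁)
            (Div-+ (Int-ν 2 · W-Δ₁ (pw± 1) 1 (±Int 1) ⊖ Div-weaken 1 2 F₂) (Div-weaken 1 2 F₁)
              ⊖ Div-* Div-P (Int⇒Div0 (Int-* Int-P (Int-+ iG₂ (Int-neg iG₁)))))

          Δe₃ : Div 1 (ν 4 * (e₃ - e₂))
          Δe₃ = subst (Div 1)
            (solve 9 (λ p x y e f a b c d →
                κ 2 :* (y :- x) :- (κ 2 :* y :- (κ 4 :* f :+ p :* p :* a :* b)) :+ (κ 2 :* x :- (κ 4 :* e :+ p :* p :* c :* d)) :- p :* (p :* (a :* b :- c :* d)) :=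
                κ 4 :* (f :- e)) refl P τ₂ τ₃ e₂ e₃ (N₁ 3 * (N₁ 3 - 1#)) ε₃ (N₁ 2 * (N₁ 2 - 1#)) ε₂)
            (Div-+ (Int-ν 2 · W-Δ₁ (pw± 1) 2 (±Int 1) ⊖ Div-weaken 1 2 F₃) (Div-weaken 1 2 F₂)
              ⊖ Div-* Div-P (Int⇒Div0 (Int-* Int-P (Int-+ iG₃ (Int-neg iG₂)))))

          Δ²e : Div 2 (ν 4 * (e₃ - ν 2 * e₂ + e₁))
          Δ²e = subst (Div 2)
            (solve 13 (λ p x y z e f g a₁ b₁ a₂ b₂ a₃ b₃ →
                κ 2 :* (z :- κ 2 :* y :+ x) :- (κ 2 :* z :- (κ 4 :* g :+ p :* p :* a₃ :* b₃)) :+ κ 2 :* (κ 2 :* y :- (κ 4 :* f :+ p :* p :* a₂ :* b₂))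
                  :- (κ 2 :* x :- (κ 4 :* e :+ p :* p :* a₁ :* b₁)) :- p :* (p :* (a₃ :* b₃ :- κ 2 :* (a₂ :* b₂) :+ a₁ :* b₁)) :=
                κ 4 :* (g :- κ 2 :* f :+ e)) refl
              P τ₁ τ₂ τ₃ e₁ e₂ e₃ (N₁ 1 * (N₁ 1 - 1#)) ε₁ (N₁ 2 * (N₁ 2 - 1#)) ε₂ (N₁ 3 * (N₁ 3 - 1#)) ε₃)
            (Div-+ (Int-ν 2 · W-Δ₂ (pw± 1) 1 (±Int 1) ⊖ Div-weaken 2 1 F₃) (Int-ν 2 · Div-weaken 2 1 F₂) ⊖ Div-weaken 2 1 F₁
              ⊖ Div-* Div-P (Div-* Div-P (Int⇒Div0 (Int-+ (Int-+ iG₃ (Int-neg (Int-* (Int-ν 2) iG₂))) iG₁))))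

          -- Here N ≡ 1 - j, so N(N - 1) ≡ 0, 2, 6 (mod p) and the combination reduces to 6(ε₃ -
          -- ε₂).
          G-cancellation : Div 1 (G₃ - ν 3 * G₂ + ν 3 * G₁)
          G-cancellation = subst (Div 1)
            (solve 4 (λ p a b c → let n₁ = κ 1 :+ κ 1 :* (p :- κ 1) ; n₂ = κ 1 :+ κ 2 :* (p :- κ 1) ; n₃ = κ 1 :+ κ 3 :* (p :- κ 1) in
                κ 6 :* (c :- b) :+ p :* ((κ 9 :* p :- κ 15) :* c :+ (κ 18 :- κ 12 :* p) :* b :+ (κ 3 :* p :- κ 3) :* a) :=
                n₃ :* (n₃ :- κ 1) :* c :- κ 3 :* (n₂ :* (n₂ :- κ 1) :* b) :+ κ 3 :* (n₁ :* (n₁ :- κ 1) :* a)) refl P ε₁ ε₂ ε₃)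
            (Div-+ (Int-ν 6 · ε₃-ε₂) (Div-* Div-P (Int⇒Div0 (Int-+ (Int-+
              (Int-* (Int-+ (Int-* (Int-ν 9) Int-P) (Int-neg (Int-ν 15))) (Int-e _))
              (Int-* (Int-+ (Int-ν 18) (Int-neg (Int-* (Int-ν 12) Int-P))) (Int-e _)))
              (Int-* (Int-+ (Int-* (Int-ν 3) Int-P) (Int-neg (Int-ν 3))) (Int-e _))))))

          -- The only difference that reaches down to j = 0; there `W±-zero` replaces the expansion
          -- modulo p³ and leaves p - 1.
          Δ³e : Div 3 (ν 4 * (e₃ - ν 3 * e₂ + ν 3 * e₁) - (P - 1#))
          Δ³e = subst (Div 3)
            (trans (solve 14 (λ p o x y z e f g a₁ b₁ a₂ b₂ a₃ b₃ →
                κ 2 :* (z :- κ 3 :* y :+ κ 3 :* x :- o) :- (κ 2 :* z :- (κ 4 :* g :+ p :* p :* a₃ :* b₃)) :+ κ 3 :* (κ 2 :* y :- (κ 4 :* f :+ p :* p :* a₂ :* b₂))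
                  :- κ 3 :* (κ 2 :* x :- (κ 4 :* e :+ p :* p :* a₁ :* b₁)) :- p :* (p :* (a₃ :* b₃ :- κ 3 :* (a₂ :* b₂) :+ κ 3 :* (a₁ :* b₁))) :=
                κ 4 :* (g :- κ 3 :* f :+ κ 3 :* e) :- κ 2 :* o) refl
              P τ₀ τ₁ τ₂ τ₃ e₁ e₂ e₃ (N₁ 1 * (N₁ 1 - 1#)) ε₁ (N₁ 2 * (N₁ 2 - 1#)) ε₂ (N₁ 3 * (N₁ 3 - 1#)) ε₃)
              (cong (λ z → ν 4 * (e₃ - ν 3 * e₂ + ν 3 * e₁) - z) W±-zero))
            (Div-+ (Int-ν 2 · W-Δ₃ (pw± 1) 0 (±Int 1) ⊖ F₃) (Int-ν 3 · F₂) ⊖ Int-ν 3 · F₁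
              ⊖ Div-* Div-P (Div-* Div-P G-cancellation))

          -- Since 4 (1 − 4uʲ) = −12 − 16 (uʲ − 1), each difference of the β's is, up to the unit −12, the difference
          -- of the e's plus u − 1 times a difference of lower order.
          Δβ₂ : Div 1 (β₂ - β₁)
          Δβ₂ = Div-unit p∤12 (subst (Div 1)
            (solve 3 (λ u a b → :- (κ 4 :* ((κ 1 :- κ 4 :* (u :* (u :* κ 1))) :* b :- (κ 1 :- κ 4 :* (u :* κ 1)) :* a)) :- (u :- κ 1) :* (κ 16 :* ((u :+ κ 1) :* b :- a)) :=
              κ 12 :* (b :- a)) refl u β₁ β₂)
            (Div-neg Δe₂ ⊖ Div-* Div-u (Int⇒Div0 (Int-* (Int-ν 16) (Int-+ (Int-* (Int-+ Int-u (Int-ν 1)) iβ₂) (Int-neg iβ₁))))))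

          Δβ₃ : Div 1 (β₃ - β₂)
          Δβ₃ = Div-unit p∤12 (subst (Div 1)
            (solve 3 (λ u a b → :- (κ 4 :* ((κ 1 :- κ 4 :* (u :* (u :* (u :* κ 1)))) :* b :- (κ 1 :- κ 4 :* (u :* (u :* κ 1))) :* a))
                :- (u :- κ 1) :* (κ 16 :* ((u :* u :+ u :+ κ 1) :* b :- (u :+ κ 1) :* a)) :=
              κ 12 :* (b :- a)) refl u β₂ β₃)
            (Div-neg Δe₃ ⊖ Div-* Div-u (Int⇒Div0 (Int-* (Int-ν 16)
              (Int-+ (Int-* (Int-+ (Int-+ (Int-* Int-u Int-u) Int-u) (Int-ν 1)) iβ₃) (Int-neg (Int-* (Int-+ Int-u (Int-ν 1)) iβ₂)))))))

          Δ²β : Div 2 (β₃ - ν 2 * β₂ + β₁)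
          Δ²β = Div-unit p∤12 (subst (Div 2)
            (solve 4 (λ u a b c → :- (κ 4 :* ((κ 1 :- κ 4 :* (u :* (u :* (u :* κ 1)))) :* c :- κ 2 :* ((κ 1 :- κ 4 :* (u :* (u :* κ 1))) :* b) :+ (κ 1 :- κ 4 :* (u :* κ 1)) :* a))
                :- κ 16 :* ((u :- κ 1) :* (κ 3 :* (c :- b) :- (b :- a) :+ (u :- κ 1) :* (κ 3 :* c :- κ 2 :* b :+ (u :- κ 1) :* c))) :=
              κ 12 :* (c :- κ 2 :* b :+ a)) refl u β₁ β₂ β₃)
            (Div-neg Δ²e ⊖ Int-ν 16 · Div-* Div-u (Div-+ (Int-ν 3 · Δβ₃ ⊖ Δβ₂)
              (Div-* Div-u (Int⇒Div0 (Int-+ (Int-+ (Int-* (Int-ν 3) iβ₃) (Int-neg (Int-* (Int-ν 2) iβ₂))) (Int-* Int-w iβ₃)))))))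

          Δ³β : Div 3 (ν 12 * (β₃ - ν 3 * β₂ + ν 3 * β₁) - (1# - P))
          Δ³β = subst (Div 3)
            (solve 5 (λ p u a b c → :- (κ 4 :* ((κ 1 :- κ 4 :* (u :* (u :* (u :* κ 1)))) :* c :- κ 3 :* ((κ 1 :- κ 4 :* (u :* (u :* κ 1))) :* b) :+ κ 3 :* ((κ 1 :- κ 4 :* (u :* κ 1)) :* a)) :- (p :- κ 1))
                -- Put w = u - 1. In u³c - 3u²b + 3ua the coefficients of w, w², w³ are 3(c - 2b +
                -- a), 3(c - b) and c, and each one supplies the factors p missing to p³.
                :- κ 16 :* ((u :- κ 1) :* (κ 3 :* (c :- κ 2 :* b :+ a) :+ (u :- κ 1) :* (κ 3 :* (c :- b) :+ (u :- κ 1) :* c))) :=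
              κ 12 :* (c :- κ 3 :* b :+ κ 3 :* a) :- (κ 1 :- p)) refl P u β₁ β₂ β₃)
            (Div-neg Δ³e ⊖ Int-ν 16 · Div-* Div-u (Div-+ (Int-ν 3 · Δ²β) (Div-* Div-u (Div-+ (Int-ν 3 · Δβ₃) (Div-* Div-u (Int⇒Div0 iβ₃))))))

        -- The congruence for H_{p-1,p-3}

        N₂ : ℕ → K
        N₂ j = ν 2 + ν j * (P - 1#)

        sumOfSquares : ∀ n → ν 6 * ∑ n (λ a → pw 2 a * 1#) ≡ ν n * (ν n + 1#) * (ν 2 * ν n + 1#)
        sumOfSquares zero    = solve 0 (κ 6 :* κ 0 := κ 0 :* (κ 0 :+ κ 1) :* (κ 2 :* κ 0 :+ κ 1)) refl
        sumOfSquares (suc n) = begin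
          ν 6 * (∑ n (λ a → pw 2 a * 1#) + pw 2 n * 1#)
            ≡⟨ distribˡ _ _ _ ⟩
          ν 6 * ∑ n (λ a → pw 2 a * 1#) + ν 6 * (pw 2 n * 1#)
            ≡⟨ cong₂ (λ x y → x + ν 6 * (y * (y * 1#) * 1#)) (sumOfSquares n) (ν-suc n) ⟩
          ν n * (ν n + 1#) * (ν 2 * ν n + 1#) + ν 6 * ((1# + ν n) * ((1# + ν n) * 1#) * 1#)
            ≡⟨ solve 1 (λ n → n :* (n :+ κ 1) :* (κ 2 :* n :+ κ 1) :+ κ 6 :* ((κ 1 :+ n) :* ((κ 1 :+ n) :* κ 1) :* κ 1) :=
                 (κ 1 :+ n) :* (κ 1 :+ n :+ κ 1) :* (κ 2 :* (κ 1 :+ n) :+ κ 1)) refl (ν n) ⟩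
          (1# + ν n) * (1# + ν n + 1#) * (ν 2 * (1# + ν n) + 1#)
            ≡⟨ cong (λ z → z * (z + 1#) * (ν 2 * z + 1#)) (ν-suc n) ⟨
          ν (suc n) * (ν (suc n) + 1#) * (ν 2 * ν (suc n) + 1#) ∎
          where open ≡-Reasoning

        module Part₁ where
          v₁ v₂ v₃ w₀ w₁ w₂ w₃ : K
          v₁ = P * b M
          v₂ = P * b (2 ℕ.* M)
          v₃ = P * b (3 ℕ.* M)
          w₀ = W (pw 2) 0
          w₁ = W (pw 2) 1
          w₂ = W (pw 2) 2
          w₃ = W (pw 2) 3

          -- An exact equality, the sum of squares (p - 1)p(2p - 1)/6, put into the shape of the
          -- other three congruences.
          ε₀ : Div 4 (ν 6 * w₀ - (P - 1#) * P * (ν 2 * P - 1#))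
          ε₀ = subst (Div 4) (trans (solve 1 (λ p → κ 0 := (p :- κ 1) :* (p :- κ 1 :+ κ 1) :* (κ 2 :* (p :- κ 1) :+ κ 1) :- (p :- κ 1) :* p :* (κ 2 :* p :- κ 1)) refl P)
            (cong (_- (P - 1#) * P * (ν 2 * P - 1#)) (sym (trans (sumOfSquares M) (cong (λ z → z * (z + 1#) * (ν 2 * z + 1#)) νM))))) Div-0

          shift : ∀ {n} s → 4 ℕ.+ 2 ℕ.* suc s ≡ n → 4 ℕ.+ 2 ℕ.* suc (suc s) ≡ 2 ℕ.+ n
          shift s eq = trans (cong (4 ℕ.+_) (ℕP.*-suc 2 (suc s))) (cong (2 ℕ.+_) eq)

          W₂-mod-p⁴ : ∀ {n} s j → 4 ℕ.+ 2 ℕ.* suc s ≡ n → n ≡ 0 ℕ.+ j ℕ.* M →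
            Div 4 (ν 6 * W (pw 2) j - (ν 6 * (P * (N₂ j * β (suc n))) + P * P * (N₂ j * (N₂ j - 1#)) * (P * b n)))
          W₂-mod-p⁴ {n} s j eq eq′ = subst (λ z → Div 4 (ν 6 * W (pw 2) j - (ν 6 * (P * z) + P * P * (N₂ j * (N₂ j - 1#)) * (P * b n))))
            (trans (b-β (suc n)) (cong (_* β (suc n)) (ν-affine 2 j (cong (2 ℕ.+_) eq′))))
            (W-mod-p⁴ (suc s) 2 j (shift s eq) (cong (2 ℕ.+_) eq′))

          ε₁ : Div 4 (ν 6 * w₁ - (ν 6 * (P * (N₂ 1 * β₁)) + P * P * (N₂ 1 * (N₂ 1 - 1#)) * v₁))
          ε₁ = W₂-mod-p⁴ t 1 M≡ (sym (ℕP.*-identityˡ M))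

          ε₂ : Div 4 (ν 6 * w₂ - (ν 6 * (P * (N₂ 2 * β₂)) + P * P * (N₂ 2 * (N₂ 2 - 1#)) * v₂))
          ε₂ = W₂-mod-p⁴ (3 ℕ.+ 2 ℕ.* t) 2 2M refl

          ε₃ : Div 4 (ν 6 * w₃ - (ν 6 * (P * (N₂ 3 * β₃)) + P * P * (N₂ 3 * (N₂ 3 - 1#)) * v₃))
          ε₃ = W₂-mod-p⁴ (6 ℕ.+ 3 ℕ.* t) 3 3M refl

          θ : ∀ {n} s j → 4 ℕ.+ 2 ℕ.* suc s ≡ n → n ≡ 0 ℕ.+ j ℕ.* M → Div 2 (W (pw 0) j - P * b n)
          θ s j eq = W-mod-p² (suc s) 0 j (trans (cong (2 ℕ.+_) (ℕP.*-suc 2 (suc s))) eq)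

          θ₁ : Div 2 (W (pw 0) 1 - v₁)
          θ₁ = θ t 1 M≡ (sym (ℕP.*-identityˡ M))

          θ₂ : Div 2 (W (pw 0) 2 - v₂)
          θ₂ = θ (3 ℕ.+ 2 ℕ.* t) 2 2M refl

          θ₃ : Div 2 (W (pw 0) 3 - v₃)
          θ₃ = θ (6 ℕ.+ 3 ℕ.* t) 3 3M refl

          -- The second difference of the sums with weight 1, starting from p - 1 at j = 0. Together
          -- with `γ₃` it removes pB_{2(p-1)} and pB_{3(p-1)} from the p²-terms in favour of
          -- pB_{p-1}.
          γ₂ : Div 2 (v₂ - ν 2 * v₁ + (P - 1#))
          γ₂ = subst (Div 2)
            (trans (solve 5 (λ a b c v₁ v₂ → c :- κ 2 :* b :+ a :- (c :- v₂) :+ κ 2 :* (b :- v₁) := v₂ :- κ 2 :* v₁ :+ a) refl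
                (W (pw 0) 0) (W (pw 0) 1) (W (pw 0) 2) v₁ v₂)
              (cong (v₂ - ν 2 * v₁ +_) W0))
            (Div-+ (W-Δ₂ (pw 0) 0 Int-pw0 ⊖ θ₂) (Int-ν 2 · θ₁))

          γ₃ : Div 2 (v₃ - ν 3 * v₁ + ν 2 * (P - 1#))
          γ₃ = subst (Div 2)
            (trans (solve 5 (λ a b d v₁ v₃ → d :- κ 3 :* b :+ κ 2 :* a :- (d :- v₃) :+ κ 3 :* (b :- v₁) := v₃ :- κ 3 :* v₁ :+ κ 2 :* a) refl
                (W (pw 0) 0) (W (pw 0) 1) (W (pw 0) 3) v₁ v₃)
              (cong (λ z → v₃ - ν 3 * v₁ + ν 2 * z) W0))
            (Div-+ (W-Δ₂′ (pw 0) 0 Int-pw0 ⊖ θ₃) (Int-ν 3 · θ₁))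

          H : K
          H = ∑ M (λ a → inv a ^ (M ∸ 2))

          inv-shift : ∀ {m} a → M ≡ 2 ℕ.+ m → pw 2 a * inv a ^ M ≡ inv a ^ (M ∸ 2)
          inv-shift {m} a refl = trans (solve 3 (λ x i y → x :* (x :* κ 1) :* (i :* (i :* y)) := x :* i :* (x :* i) :* y) refl (ν (suc a)) (inv a) (inv a ^ m))
            (trans (cong (λ z → z * z * inv a ^ m) (inv-inverse a)) (solve 1 (λ y → κ 1 :* κ 1 :* y := y) refl (inv a ^ m)))

          H-reduced : Div 4 (H - (ν 4 * w₀ - ν 6 * w₁ + ν 4 * w₂ - w₃))
          H-reduced = subst (λ h → Div 4 (h - (ν 4 * w₀ - ν 6 * w₁ + ν 4 * w₂ - w₃)))
            (∑-cong M λ a _ → inv-shift a (sym M≡)) (W-inverse (pw 2) (Int-pw 2))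

          rhs : K
          rhs = ν 37 * inv 11 * (P * P * P) - ν 3 * (P * P) + ν 3 * inv 3 * P
            - P * P * v₁
            + ν 3 * P * (P - ν 3) * β₁
            - inv 1 * (P - ν 3 + ν 11 * inv 1 * (P * P * P)) * b (2 ℕ.* p)

          12*rhs : ν 12 * rhs ≡ ν 37 * (P * P * P) - ν 36 * (P * P) + ν 9 * P - ν 12 * (P * P * v₁)
            + ν 36 * P * (P - ν 3) * β₁ - (ν 6 * (P - ν 3) + ν 33 * (P * P * P)) * (N₂ 2 * β₂)
          12*rhs = begin
            ν 12 * rhs
              ≡⟨ solve 7 (λ p i₁₁ i₃ i₁ v β x →
                   κ 12 :* (κ 37 :* i₁₁ :* (p :* p :* p) :- κ 3 :* (p :* p) :+ κ 3 :* i₃ :* p :- p :* p :* v :+ κ 3 :* p :* (p :- κ 3) :* β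
                     :- i₁ :* (p :- κ 3 :+ κ 11 :* i₁ :* (p :* p :* p)) :* x) :=
                   κ 12 :* i₁₁ :* (κ 37 :* (p :* p :* p)) :- κ 36 :* (p :* p) :+ κ 4 :* i₃ :* (κ 9 :* p) :- κ 12 :* (p :* p :* v) :+ κ 36 :* p :* (p :- κ 3) :* β
                     :- κ 2 :* i₁ :* (κ 6 :* (p :- κ 3) :+ κ 2 :* i₁ :* (κ 33 :* (p :* p :* p))) :* x) refl
                   P (inv 11) (inv 3) (inv 1) v₁ β₁ (b (2 ℕ.* p)) ⟩
            form (ν 12 * inv 11) (ν 4 * inv 3) (ν 2 * inv 1) (b (2 ℕ.* p))
              ≡⟨ cong₂ (λ x y → form x y (ν 2 * inv 1) (b (2 ℕ.* p))) (inv-inverse 11) (inv-inverse 3) ⟩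
            form 1# 1# (ν 2 * inv 1) (b (2 ℕ.* p))
              ≡⟨ cong₂ (form 1# 1#) (inv-inverse 1) b-2p ⟩
            form 1# 1# 1# (N₂ 2 * β₂)
              ≡⟨ solve 4 (λ p v β x →
                   κ 1 :* (κ 37 :* (p :* p :* p)) :- κ 36 :* (p :* p) :+ κ 1 :* (κ 9 :* p) :- κ 12 :* (p :* p :* v) :+ κ 36 :* p :* (p :- κ 3) :* β
                     :- κ 1 :* (κ 6 :* (p :- κ 3) :+ κ 1 :* (κ 33 :* (p :* p :* p))) :* x :=
                   κ 37 :* (p :* p :* p) :- κ 36 :* (p :* p) :+ κ 9 :* p :- κ 12 :* (p :* p :* v) :+ κ 36 :* p :* (p :- κ 3) :* β
                     :- (κ 6 :* (p :- κ 3) :+ κ 33 :* (p :* p :* p)) :* x) refl P v₁ β₁ (N₂ 2 * β₂) ⟩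
            ν 37 * (P * P * P) - ν 36 * (P * P) + ν 9 * P - ν 12 * (P * P * v₁)
              + ν 36 * P * (P - ν 3) * β₁ - (ν 6 * (P - ν 3) + ν 33 * (P * P * P)) * (N₂ 2 * β₂) ∎
            where
            open ≡-Reasoning
            form : K → K → K → K → K
            form i₁₁ i₃ i₁ x = i₁₁ * (ν 37 * (P * P * P)) - ν 36 * (P * P) + i₃ * (ν 9 * P) - ν 12 * (P * P * v₁)
              + ν 36 * P * (P - ν 3) * β₁ - i₁ * (ν 6 * (P - ν 3) + i₁ * (ν 33 * (P * P * P))) * x
            b-2p : b (2 ℕ.* p) ≡ N₂ 2 * β₂
            b-2p = trans (cong b (ℕP.*-suc 2 M)) (trans (b-β n₂) (cong (_* β₂) (ν-affine 2 2 refl)))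

          Int-N₂ : ∀ j → Int (N₂ j)
          Int-N₂ j = Int-+ (Int-ν 2) (Int-* (Int-ν j) (Int-+ Int-P (Int-neg (Int-ν 1))))

          Int-NN₂ : ∀ j → Int (N₂ j * (N₂ j - 1#))
          Int-NN₂ j = Int-* (Int-N₂ j) (Int-+ (Int-N₂ j) (Int-neg (Int-ν 1)))

          result : Div 4 (H - rhs)
          result = Div-unit p∤12 (subst (Div 4)
            (trans (solve 12 (λ p h w₀ w₁ w₂ w₃ β₁ β₂ β₃ v₁ v₂ v₃ →
                let m = p :- κ 1 ; n₁ = κ 2 :+ κ 1 :* m ; n₂ = κ 2 :+ κ 2 :* m ; n₃ = κ 2 :+ κ 3 :* m
                    q₁ = n₁ :* (n₁ :- κ 1) ; q₂ = n₂ :* (n₂ :- κ 1) ; q₃ = n₃ :* (n₃ :- κ 1) in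
                κ 12 :* (h :- (κ 4 :* w₀ :- κ 6 :* w₁ :+ κ 4 :* w₂ :- w₃))
                  :+ κ 8 :* (κ 6 :* w₀ :- m :* p :* (κ 2 :* p :- κ 1))
                  :- κ 12 :* (κ 6 :* w₁ :- (κ 6 :* (p :* (n₁ :* β₁)) :+ p :* p :* q₁ :* v₁))
                  :+ κ 8 :* (κ 6 :* w₂ :- (κ 6 :* (p :* (n₂ :* β₂)) :+ p :* p :* q₂ :* v₂))
                  :- κ 2 :* (κ 6 :* w₃ :- (κ 6 :* (p :* (n₃ :* β₃)) :+ p :* p :* q₃ :* v₃))
                  -- Kummer's congruence removes β₃, since B_{3p-1} is absent from the right-hand
                  -- side.
                  :- n₃ :* (p :* (κ 12 :* (β₃ :- κ 3 :* β₂ :+ κ 3 :* β₁) :- (κ 1 :- p)))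
                  :+ p :* (p :* (κ 8 :* (q₂ :* (v₂ :- κ 2 :* v₁ :+ m)) :- κ 2 :* (q₃ :* (v₃ :- κ 3 :* v₁ :+ κ 2 :* m))))
                  -- After the elimination by `γ₂` and `γ₃` the v₁-terms are p²(12 - 10p + 2p²)v₁.
                  -- The first belongs to the right-hand side, and v₁ ≡ -1 (mod p) evaluates
                  -- -10p³v₁.
                  :+ p :* (p :* (p :* (κ 10 :* (v₁ :+ κ 1))))
                  -- Explicit multiples of p⁴. The summand 66β₂ comes from 33p³B_{2p}, since B_{2p}
                  -- = 2pβ₂.
                  :+ (κ 4 :* p :- κ 24 :- κ 2 :* v₁ :+ κ 66 :* β₂) :* (p :* (p :* (p :* (p :* κ 1)))) :=
                κ 12 :* h :- (κ 37 :* (p :* p :* p) :- κ 36 :* (p :* p) :+ κ 9 :* p :- κ 12 :* (p :* p :* v₁)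
                  :+ κ 36 :* p :* (p :- κ 3) :* β₁ :- (κ 6 :* (p :- κ 3) :+ κ 33 :* (p :* p :* p)) :* (n₂ :* β₂))) refl
                P H w₀ w₁ w₂ w₃ β₁ β₂ β₃ v₁ v₂ v₃)
              (trans (cong (λ z → ν 12 * H - z) (sym 12*rhs)) (solve 2 (λ h r → κ 12 :* h :- κ 12 :* r := κ 12 :* (h :- r)) refl H rhs)))
            (Div-+ (Div-+ (Div-+ (Div-+ (Div-+ (Int-ν 12 · H-reduced) (Int-ν 8 · ε₀) ⊖ Int-ν 12 · ε₁) (Int-ν 8 · ε₂) ⊖ Int-ν 2 · ε₃
                ⊖ Int-N₂ 3 · Div-* Div-P Kummer.Δ³β)
                (Div-* Div-P (Div-* Div-P (Int-ν 8 · Int-NN₂ 2 · γ₂ ⊖ Int-ν 2 · Int-NN₂ 3 · γ₃))))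
                (Div-* Div-P (Div-* Div-P (Div-* Div-P (Int-ν 10 · Pb+1 t 1 M≡ (sym (ℕP.*-identityˡ M)))))))
              (Int-+ (Int-+ (Int-+ (Int-* (Int-ν 4) Int-P) (Int-neg (Int-ν 24))) (Int-neg (Int-* (Int-ν 2) (Int-Pb M)))) (Int-* (Int-ν 66) iβ₂)
                · Div-P^ 4)))

-- The rational numbers as an instance

open import Defs
open import Data.List using ([]; _∷_; _++_; length)
open import Data.List.Properties using (length-++)
open import Data.Rational as ℚ using (ℚ; mkℚ; _+_; _*_; _-_; -_; ↥_; ↧_; ↧ₙ_; toℚᵘ)
import Data.Rational.Properties as ℚP
open import Data.Rational.Unnormalised as ℚᵘ using (mkℚᵘ; *≡*; _≃_)
import Data.Rational.Unnormalised.Properties as ℚᵘP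

-- Arithmetic in `ℚ` reduces by a gcd. Among unnormalised fractions i/1 keeps its literal numerator
-- and denominator, and the homomorphism laws become identities of integers.
toℚᵘ-/1 : ∀ i → toℚᵘ (i ℚ./ 1) ≃ mkℚᵘ i 0
toℚᵘ-/1 i = ℚP.toℚᵘ-fromℚᵘ (mkℚᵘ i 0)

/1-+ : ∀ i j → (i ℤ.+ j) ℚ./ 1 ≡ i ℚ./ 1 + j ℚ./ 1
/1-+ i j = ℚP.toℚᵘ-injective (begin
  toℚᵘ ((i ℤ.+ j) ℚ./ 1)               ≈⟨ toℚᵘ-/1 (i ℤ.+ j) ⟩
  mkℚᵘ (i ℤ.+ j) 0                     ≈⟨ *≡* (cong (ℤ._* pos 1) (sym (cong₂ ℤ._+_ (ℤP.*-identityʳ i) (ℤP.*-identityʳ j)))) ⟩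
  mkℚᵘ i 0 ℚᵘ.+ mkℚᵘ j 0               ≈⟨ ℚᵘP.+-cong (toℚᵘ-/1 i) (toℚᵘ-/1 j) ⟨
  toℚᵘ (i ℚ./ 1) ℚᵘ.+ toℚᵘ (j ℚ./ 1)   ≈⟨ ℚP.toℚᵘ-homo-+ (i ℚ./ 1) (j ℚ./ 1) ⟨
  toℚᵘ (i ℚ./ 1 + j ℚ./ 1)             ∎)
  where open ℚᵘP.≃-Reasoning

/1-* : ∀ i j → (i ℤ.* j) ℚ./ 1 ≡ i ℚ./ 1 * (j ℚ./ 1)
/1-* i j = ℚP.toℚᵘ-injective (begin
  toℚᵘ ((i ℤ.* j) ℚ./ 1)               ≈⟨ toℚᵘ-/1 (i ℤ.* j) ⟩
  mkℚᵘ i 0 ℚᵘ.* mkℚᵘ j 0               ≈⟨ ℚᵘP.*-cong (toℚᵘ-/1 i) (toℚᵘ-/1 j) ⟨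
  toℚᵘ (i ℚ./ 1) ℚᵘ.* toℚᵘ (j ℚ./ 1)   ≈⟨ ℚP.toℚᵘ-homo-* (i ℚ./ 1) (j ℚ./ 1) ⟨
  toℚᵘ (i ℚ./ 1 * (j ℚ./ 1))           ∎)
  where open ℚᵘP.≃-Reasoning

/1-neg : ∀ i → (ℤ.- i) ℚ./ 1 ≡ - (i ℚ./ 1)
/1-neg i = ℚP.toℚᵘ-injective (begin
  toℚᵘ ((ℤ.- i) ℚ./ 1)     ≈⟨ toℚᵘ-/1 (ℤ.- i) ⟩
  ℚᵘ.- mkℚᵘ i 0            ≈⟨ ℚᵘP.-‿cong (toℚᵘ-/1 i) ⟨
  ℚᵘ.- toℚᵘ (i ℚ./ 1)      ≈⟨ ℚP.toℚᵘ-homo‿- (i ℚ./ 1) ⟨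
  toℚᵘ (- (i ℚ./ 1))       ∎)
  where open ℚᵘP.≃-Reasoning

/1-injective : ∀ {i j} → i ℚ./ 1 ≡ j ℚ./ 1 → i ≡ j
/1-injective {i} {j} eq with ℚᵘP.≃-trans (ℚᵘP.≃-sym (toℚᵘ-/1 i)) (ℚᵘP.≃-trans (ℚᵘP.≃-reflexive (cong toℚᵘ eq)) (toℚᵘ-/1 j))
... | *≡* i1≡j1 = ℤP.*-cancelʳ-≡ i j (pos 1) i1≡j1

*-denominator : ∀ r → r * (↧ r ℚ./ 1) ≡ ↥ r ℚ./ 1
*-denominator r@(mkℚ n d-1 _) = ℚP.toℚᵘ-injective (begin
  toℚᵘ (r * (↧ r ℚ./ 1))              ≈⟨ ℚP.toℚᵘ-homo-* r (↧ r ℚ./ 1) ⟩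
  toℚᵘ r ℚᵘ.* toℚᵘ (↧ r ℚ./ 1)        ≈⟨ ℚᵘP.*-cong {toℚᵘ r} ℚᵘP.≃-refl (toℚᵘ-/1 (↧ r)) ⟩
  mkℚᵘ n d-1 ℚᵘ.* mkℚᵘ (↧ r) 0        ≈⟨ *≡* (trans (ℤP.*-identityʳ (n ℤ.* ↧ r)) (cong (λ z → n ℤ.* pos (suc z)) (sym (ℕP.*-identityʳ d-1)))) ⟩
  mkℚᵘ n 0                            ≈⟨ toℚᵘ-/1 n ⟨
  toℚᵘ (n ℚ./ 1)                      ∎)
  where open ℚᵘP.≃-Reasoning

reciprocal : ∀ n → (pos (suc n)) ℚ./ 1 * (pos 1 ℚ./ suc n) ≡ pos 1 ℚ./ 1
reciprocal n = ℚP.toℚᵘ-injective (begin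
  toℚᵘ ((pos (suc n)) ℚ./ 1 * (pos 1 ℚ./ suc n))               ≈⟨ ℚP.toℚᵘ-homo-* ((pos (suc n)) ℚ./ 1) (pos 1 ℚ./ suc n) ⟩
  toℚᵘ ((pos (suc n)) ℚ./ 1) ℚᵘ.* toℚᵘ (pos 1 ℚ./ suc n)       ≈⟨ ℚᵘP.*-cong (toℚᵘ-/1 (pos (suc n))) (ℚP.toℚᵘ-fromℚᵘ (mkℚᵘ (pos 1) n)) ⟩
  mkℚᵘ (pos (suc n)) 0 ℚᵘ.* mkℚᵘ (pos 1) n                     ≈⟨ *≡* (trans (ℤP.*-identityʳ _) (trans (ℤP.*-identityʳ (pos (suc n))) (sym (trans (ℤP.*-identityˡ _) (cong (λ z → pos (suc z)) (ℕP.+-identityʳ n)))))) ⟩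
  mkℚᵘ (pos 1) 0                                           ∎)
  where open ℚᵘP.≃-Reasoning

ℚ-algebra : RationalAlgebra
ℚ-algebra = record
  { Carrier = ℚ ; _+_ = _+_ ; _*_ = _*_ ; -_ = -_ ; ι = ℚ._/ 1
  ; isCommutativeRing = ℚP.+-*-isCommutativeRing
  ; ι-+ = /1-+ ; ι-* = /1-* ; ι-neg = /1-neg
  ; inv = λ n → pos 1 ℚ./ suc n ; inv-inverse = reciprocal }

open Sequences ℚ-algebra using (∑; ∑-cong; ∑-front; _^_)

-- Bernoulli numbers and harmonic sums as given in the statement

nth-++ˡ : ∀ xs ys {k} → k < length xs → nth (xs ++ ys) k ≡ nth xs k
nth-++ˡ (x ∷ xs) ys {zero}  _         = refl
nth-++ˡ (x ∷ xs) ys {suc k} (s≤s k<n) = nth-++ˡ xs ys k<n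

nth-snoc : ∀ xs y → nth (xs ++ y ∷ []) (length xs) ≡ y
nth-snoc []       y = refl
nth-snoc (x ∷ xs) y = nth-snoc xs y

length-bernList : ∀ n → length (bernList n) ≡ suc n
length-bernList zero    = refl
length-bernList (suc n) = trans (length-++ (bernList n)) (trans (cong (ℕ._+ 1) (length-bernList n)) (ℕP.+-comm (suc n) 1))

-- `bernList` only ever appends, so an entry keeps its value in all longer lists.
nth-bernList : ∀ {n k} → k ≤ n → nth (bernList n) k ≡ B k
nth-bernList {zero}  {zero} _   = refl
nth-bernList {suc n} {k}    k≤n with ℕP.m≤n⇒m<n∨m≡n k≤n
... | inj₂ refl      = refl
... | inj₁ (s≤s k≤′) = trans (nth-++ˡ (bernList n) _ (subst (k <_) (sym (length-bernList n)) (s≤s k≤′))) (nth-bernList k≤′)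

binSum-∑ : ∀ m k bs → binSum m k bs ≡ ∑ (length bs) (λ i → q (suc m C (k ℕ.+ i)) * nth bs i)
binSum-∑ m k []       = refl
binSum-∑ m k (x ∷ bs) = begin
  q (suc m C k) * x + binSum m (suc k) bs
    ≡⟨ cong (q (suc m C k) * x +_) (binSum-∑ m (suc k) bs) ⟩
  q (suc m C k) * x + ∑ (length bs) (λ i → q (suc m C (suc k ℕ.+ i)) * nth bs i)
    ≡⟨ cong₂ (λ c s → q (suc m C c) * x + s) (sym (ℕP.+-identityʳ k))
         (∑-cong (length bs) λ i _ → cong (λ c → q (suc m C c) * nth bs i) (sym (ℕP.+-suc k i))) ⟩
  q (suc m C (k ℕ.+ 0)) * x + ∑ (length bs) (λ i → q (suc m C (k ℕ.+ suc i)) * nth bs i)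
    ≡⟨ ∑-front (length bs) _ ⟨
  ∑ (suc (length bs)) (λ i → q (suc m C (k ℕ.+ i)) * nth (x ∷ bs) i) ∎
  where open ≡-Reasoning

B-suc : ∀ n → B (suc n) ≡ - ((pos 1 ℚ./ suc (suc n)) * ∑ (suc n) (λ k → q (suc (suc n) C k) * B k))
B-suc n = trans (trans (cong (nth (bernList (suc n))) (sym (length-bernList n))) (nth-snoc (bernList n) _))
  (cong (λ z → - ((pos 1 ℚ./ suc (suc n)) * z)) (trans (binSum-∑ (suc n) 0 (bernList n))
    (trans (cong (λ l → ∑ l (λ i → q (suc (suc n) C i) * nth (bernList n) i)) (length-bernList n))
      (∑-cong (suc n) λ k k≤n → cong (q (suc (suc n) C k) *_) (nth-bernList (ℕP.≤-pred k≤n))))))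

B-recurrence : ∀ n → ∑ (suc (suc n)) (λ k → q (suc (suc n) C k) * B k) ≡ pos 0 ℚ./ 1
B-recurrence n = begin
  s + q (suc (suc n) C suc n) * B (suc n)
    ≡⟨ cong₂ (λ c y → s + q c * y) top (B-suc n) ⟩
  s + q (suc (suc n)) * - ((pos 1 ℚ./ suc (suc n)) * s)
    ≡⟨ solve 3 (λ s m i → s :+ m :* (:- (i :* s)) := s :- m :* i :* s) refl s (q (suc (suc n))) (pos 1 ℚ./ suc (suc n)) ⟩
  s - q (suc (suc n)) * (pos 1 ℚ./ suc (suc n)) * s
    ≡⟨ cong (λ z → s - z * s) (reciprocal (suc n)) ⟩
  s - (pos 1 ℚ./ 1) * s
    ≡⟨ solve 1 (λ s → s :- κ 1 :* s := κ 0) refl s ⟩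
  pos 0 ℚ./ 1 ∎
  where
  open ≡-Reasoning
  open Sequences ℚ-algebra using (solve; _:=_; _:+_; _:*_; _:-_; :-_; κ)
  s : ℚ
  s = ∑ (suc n) (λ k → q (suc (suc n) C k) * B k)
  top : suc (suc n) C suc n ≡ suc (suc n)
  top = trans (nCk≡nC[n∸k] (ℕP.n≤1+n (suc n))) (trans (cong (suc (suc n) C_) (ℕP.m+n∸n≡m 1 n)) (nC1≡n (suc (suc n))))

invPow-^ : ∀ a k → (pos 1 ℚ./ suc a) ^ k ≡ invPow a k
invPow-^ a zero    = refl
invPow-^ a (suc k) = trans (ℚP.*-comm (pos 1 ℚ./ suc a) _) (cong (_* (pos 1 ℚ./ suc a)) (invPow-^ a k))

H-∑ : ∀ n k → ∑ n (λ a → (pos 1 ℚ./ suc a) ^ k) ≡ H n k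
H-∑ zero    k = refl
H-∑ (suc n) k = cong₂ _+_ (H-∑ n k) (invPow-^ n k)

-- From divisibility at p to congruences of reduced fractions

-- Euclid's lemma places one factor p in m; cancelling it on both sides lowers e by one.
p^e∣-cancel : ∀ {p d m} → Prime p → ¬ p ∣ d → ∀ e → p ℕ.^ e ∣ d ℕ.* m → p ℕ.^ e ∣ m
p^e∣-cancel p-prime p∤d zero    _ = 1∣ _
p^e∣-cancel {p} {d} {m} p-prime p∤d (suc e) pe∣dm@(divides c dm≡) =
  [ (λ p∣d → contradiction p∣d p∤d) , step ]′ (euclidsLemma d m p-prime (divides (c ℕ.* p ℕ.^ e)
    (trans dm≡ (trans (cong (c ℕ.*_) (ℕP.*-comm p (p ℕ.^ e))) (sym (ℕP.*-assoc c (p ℕ.^ e) p))))))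
  where
  instance _ = prime⇒nonZero p-prime
  step : p ∣ m → p ℕ.^ suc e ∣ m
  step (divides m′ refl) = subst (p ℕ.* p ℕ.^ e ∣_) (ℕP.*-comm p m′) (*-monoʳ-∣ p (p^e∣-cancel p-prime p∤d e
    (*-cancelʳ-∣ p (subst₂ _∣_ (ℕP.*-comm p (p ℕ.^ e)) (sym (ℕP.*-assoc d m′ p)) pe∣dm))))

-- The coprimality stored in a rational is proof-irrelevant; it can be recovered since equality with
-- 1 is decidable.
ℚ-coprime : ∀ r {i} → i ∣ ℤ.∣ ↥ r ∣ → i ∣ ↧ₙ r → i ≡ 1
ℚ-coprime (mkℚ _ _ coprime) {i} i∣n i∣d = recompute (i ℕ.≟ 1) (coprime (i∣n , i∣d))

module _ (M : ℕ) (p-prime : Prime (suc M)) where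
  open Sequences.Local ℚ-algebra M p-prime using (Div; mkDiv; mkInt; P)
  open Sequences ℚ-algebra using (ν-^)

  -- Cross-multiplication gives d·num = p^{e+1}·n·den with p not dividing d, so the power of p
  -- divides the numerator. The exponent is positive, hence p divides the numerator, and lowest
  -- terms keep p out of the denominator.
  Div⇒CongP : ∀ x y e → Div (suc e) (x - y) → CongP (suc M) (suc e) x y
  Div⇒CongP x y e (mkDiv z (mkInt d n p∤d dz≡n) r≡) = p^e∣-cancel p-prime p∤d (suc e) p^e∣dr , p∤den
    where
    r : ℚ
    r = x - y
    p : ℕ
    p = suc M
    crossed : pos d ℤ.* ↥ r ≡ pos (p ℕ.^ suc e) ℤ.* (n ℤ.* ↧ r)
    crossed = /1-injective (begin
      (pos d ℤ.* ↥ r) ℚ./ 1                                  ≡⟨ /1-* (pos d) (↥ r) ⟩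
      q d * (↥ r ℚ./ 1)                                    ≡⟨ cong (q d *_) (sym (*-denominator r)) ⟩
      q d * (r * D)                                        ≡⟨ cong (λ w → q d * (w * D)) r≡ ⟩
      q d * (P ^ suc e * z * D)                            ≡⟨ solve 4 (λ d p z k → d :* (p :* z :* k) := p :* (d :* z :* k)) refl (q d) (P ^ suc e) z D ⟩
      P ^ suc e * (q d * z * D)                            ≡⟨ cong₂ (λ u v → u * (v * D)) (sym (ν-^ p (suc e))) dz≡n ⟩
      q (p ℕ.^ suc e) * ((n ℚ./ 1) * D)                    ≡⟨ cong (q (p ℕ.^ suc e) *_) (/1-* n (↧ r)) ⟨
      q (p ℕ.^ suc e) * ((n ℤ.* ↧ r) ℚ./ 1)                ≡⟨ /1-* (pos (p ℕ.^ suc e)) (n ℤ.* ↧ r) ⟨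
      (pos (p ℕ.^ suc e) ℤ.* (n ℤ.* ↧ r)) ℚ./ 1              ∎)
      where
      open ≡-Reasoning
      open Sequences ℚ-algebra using (solve; _:=_; _:*_)
      D : ℚ
      D = ↧ r ℚ./ 1
    crossedₙ : d ℕ.* ℤ.∣ ↥ r ∣ ≡ p ℕ.^ suc e ℕ.* (ℤ.∣ n ∣ ℕ.* ↧ₙ r)
    crossedₙ = trans (sym (ℤP.abs-* (pos d) (↥ r))) (trans (cong ℤ.∣_∣ crossed)
      (trans (ℤP.abs-* (pos (p ℕ.^ suc e)) (n ℤ.* ↧ r)) (cong (p ℕ.^ suc e ℕ.*_) (ℤP.abs-* n (↧ r)))))
    p^e∣dr : p ℕ.^ suc e ∣ d ℕ.* ℤ.∣ ↥ r ∣
    p^e∣dr = divides (ℤ.∣ n ∣ ℕ.* ↧ₙ r) (trans crossedₙ (ℕP.*-comm (p ℕ.^ suc e) _))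
    p∤den : ¬ p ∣ ↧ₙ r
    p∤den p∣den = [ p∤d , p∤num ]′ (euclidsLemma d ℤ.∣ ↥ r ∣ p-prime (subst (p ∣_) (sym crossedₙ) (∣m⇒∣m*n _ (∣m⇒∣m*n (p ℕ.^ e) ∣-refl))))
      where
      p∤num : ¬ p ∣ ℤ.∣ ↥ r ∣
      p∤num p∣num = ¬prime[1] (subst Prime (ℚ-coprime r p∣num p∣den) p-prime)

parity : ∀ n → (∃[ k ] n ≡ 2 ℕ.* k) ⊎ (∃[ k ] n ≡ suc (2 ℕ.* k))
parity zero    = inj₁ (0 , refl)
parity (suc n) = [ (λ { (k , eq) → inj₂ (k , cong suc eq) }) , (λ { (k , eq) → inj₁ (suc k , trans (cong suc eq) (sym (ℕP.*-suc 2 k))) }) ]′ (parity n)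

-- The form says that p - 1 is even and at least 6. If p - 1 were odd, 2 would divide the prime p >
-- 5.
prime-form : ∀ M → Prime (suc M) → 5 < suc M → ∃[ t ] 4 ℕ.+ 2 ℕ.* suc t ≡ M
prime-form M p-prime 5<p with parity M
... | inj₁ (suc (suc (suc t)) , refl) = t , sym (trans (ℕP.*-suc 2 (2 ℕ.+ t)) (cong (2 ℕ.+_) (ℕP.*-suc 2 (suc t))))
... | inj₁ (zero , refl) = contradiction 5<p λ { (s≤s ()) }
... | inj₁ (suc zero , refl) = contradiction 5<p λ { (s≤s (s≤s (s≤s ()))) }
... | inj₁ (suc (suc zero) , refl) = contradiction 5<p λ { (s≤s (s≤s (s≤s (s≤s (s≤s ()))))) }
... | inj₂ (k , refl) with prime⇒irreducible p-prime (divides (suc k) (trans (sym (ℕP.*-suc 2 k)) (ℕP.*-comm 2 (suc k))))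
...   | inj₁ ()
...   | inj₂ eq = contradiction (subst (5 <_) (sym eq) 5<p) λ { (s≤s (s≤s ())) }

open import Data.Integer using (+_)

theorem2 : (p : ℕ) → Prime p → 5 < p →
    let P = q p in
    CongP p 4 (H (p ∸ 1) (p ∸ 3))
    ((+ 37 ℚ./ 12) * (P * P * P) - q 3 * (P * P) + (+ 3 ℚ./ 4) * P
    - (P * P) * (P * B (p ∸ 1))
    + q 3 * P * (P - q 3) * calB (suc p)
    - (+ 1 ℚ./ 2) * ((P - q 3) + (+ 11 ℚ./ 2) * (P * P * P)) * B (2 ℕ.* p))
    ×
    CongP p 4 (H (p ∸ 1) (p ∸ 1))
    ((q 13 * (P * P * P) + q 12 * P - q 12) * (+ 1 ℚ./ 3)
    + (q 19 * (P * P * P) - q 12) * (+ 1 ℚ./ 2) * (P * B (p ∸ 1))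
    + (q 4 - q 7 * (P * P * P)) * (P * B (2 ℕ.* (p ∸ 1)))
    + (q 11 * (P * P * P) - q 6) * (+ 1 ℚ./ 6) * (P * B (3 ℕ.* (p ∸ 1))))
theorem2 (suc M) p-prime 5<p with prime-form M p-prime 5<p
-- Closed fractions such as 37/12 have the same normal form as 37·(1/12), so both `rhs` agree with
-- the stated right-hand sides by computation.
... | t , M≡ = Div⇒CongP M p-prime (H M (M ∸ 2)) Part₁.rhs 3 (subst (λ h → Div 4 (h - Part₁.rhs)) (H-∑ M (M ∸ 2)) Part₁.result)
             , Div⇒CongP M p-prime (H M M) Part₂.rhs 3 (subst (λ h → Div 4 (h - Part₂.rhs)) (H-∑ M M) Part₂.result)
  where
  open Sequences.Local ℚ-algebra M p-prime using (Div)
  open Sequences.Local.Congruences.EvenIndices ℚ-algebra M p-prime 5<p B refl B-recurrence t M≡ using (module Part₁; module Part₂)
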